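{- Let $m\ge 3$, $1\le r\le m$, $n\ge 0$ be integers, let $d=n+m+r-1$, and let $G=K_r+L_{m,n}$ be the graph on $[d]$ whose edges are all pairs of distinct elements of $[r]$, the pairs $\{j,j+1\}$ for $r\le j\le r+n-1$, and all pairs of distinct elements of $\{r+n,\dots,r+n+m-1\}$. Then $$X_G(\mathbf{x};q)=[m-1]_q!\left(\sum_{i=0}^{r-1}q^i[r-1]_q!\,[d-2i]_q\,e_{(d-i,i)}+\sum_{j=0}^{n-1}q[n+m-j-2]_q\,X_{L_{r,j}}(\mathbf{x};q)\,e_{n+m-j-1}\right).$$ Hence $X_G(\mathbf{x};q)$ is $e$-positive and $e$-unimodal with center of symmetry $|E(G)|/2$.
   Context: $[k]_q=1+q+\dots+q^{k-1}$, $[k]_q!=[1]_q\cdots[k]_q$ ($[0]_q!=1$); $e_{(a,b)}=e_ae_b$ with $e_0=1$. For a graph $G$ on a vertex set of positive integers, $X_G(\mathbf{x};q)=\sum_\kappa q^{\mathrm{asc}(\kappa)}x^\kappa$ over proper colorings $\kappa:V(G)\to\mathbb{Z}_{>0}$, where $\mathrm{asc}(\kappa)$ counts edges $\{u,v\}$ with $u<v$, $\kappa(u)<\kappa(v)$, and $x^\kappa=\prod_vx_{\kappa(v)}$. The lollipop graph $L_{r,j}$ ($r\ge1,j\ge0$) is the graph on $[r+j]$ with edges $\{t,t+1\}$ for $1\le t\le j$ and all pairs of distinct elements of $\{j+1,\dots,j+r\}$. Writing $f=\sum_t c_t(\mathbf{x})q^t$: $f$ is $e$-positive if every $c_t$ is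 a nonnegative combination of the $e_\lambda$; $f$ is $e$-unimodal with center of symmetry $c$ if $c_t=c_{2c-t}$ for all $t$ and $c_{t+1}-c_t$ is $e$-positive for $0\le t<c-\tfrac12$. -}

module Defs where

open import Data.Bool using (Bool; true; false; _∧_; _∨_; if_then_else_)
open import Data.Nat as ℕ using (ℕ; zero; suc; _≤ᵇ_; _<ᵇ_; _≡ᵇ_)
open import Data.Integer using (ℤ; +_; _+_; _*_; _-_)
open import Data.Fin using (Fin; toℕ)
open import Data.Vec using (Vec; []; _∷_; lookup; tabulate)
open import Data.List using (List; []; _∷_; map; upTo; allFin; concatMap; foldr)
open import Data.Product using (_×_; _,_; ∃)
open import Relation.Binary.PropositionalEquality using (_≡_)

sumℤ : List ℤ → ℤ
sumℤ = foldr _+_ (+ 0)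

Σ< : ℕ → (ℕ → ℤ) → ℤ
Σ< k f = sumℤ (map f (upTo k))

countᵇ : {A : Set} → (A → Bool) → List A → ℕ
countᵇ p [] = 0
countᵇ p (x ∷ xs) = if p x then suc (countᵇ p xs) else countᵇ p xs

-- Polynomials in x_1..x_N and q with integer coefficients, represented
-- by their coefficient functions: f α t = coefficient of x^α q^t.

Mono : ℕ → Set
Mono N = Vec ℕ N

Poly : ℕ → Set
Poly N = Mono N → ℕ → ℤ

splits : ∀ {N} → Mono N → List (Mono N × Mono N)
splits [] = ([] , []) ∷ []
splits (a ∷ α) =
  concatMap (λ i → map (λ { (β , γ) → (i ∷ β , (a ℕ.∸ i) ∷ γ) }) (splits α))
            (upTo (suc a))

isZeroᵇ : ∀ {N} → Mono N → Bool
isZeroᵇ [] = true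
isZeroᵇ (a ∷ α) = (a ≡ᵇ 0) ∧ isZeroᵇ α

all≤1ᵇ : ∀ {N} → Mono N → Bool
all≤1ᵇ [] = true
all≤1ᵇ (a ∷ α) = (a ≤ᵇ 1) ∧ all≤1ᵇ α

degree : ∀ {N} → Mono N → ℕ
degree [] = 0
degree (a ∷ α) = a ℕ.+ degree α

monoEqᵇ : ∀ {N} → Mono N → Mono N → Bool
monoEqᵇ [] [] = true
monoEqᵇ (a ∷ α) (b ∷ β) = (a ≡ᵇ b) ∧ monoEqᵇ α β

infixl 6 _⊕_
infixl 7 _⊗_

_⊕_ : ∀ {N} → Poly N → Poly N → Poly N
(f ⊕ g) α t = f α t + g α t

_⊗_ : ∀ {N} → Poly N → Poly N → Poly N
(f ⊗ g) α t =
  sumℤ (map (λ { (β , γ) → Σ< (suc t) (λ s → f β s * g γ (t ℕ.∸ s)) }) (splits α))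

ΣP : ∀ {N} → ℕ → (ℕ → Poly N) → Poly N
ΣP k F α t = Σ< k (λ i → F i α t)

qpow : ∀ {N} → ℕ → Poly N
qpow k α t = if isZeroᵇ α ∧ (t ≡ᵇ k) then + 1 else + 0

qint : ∀ {N} → ℕ → Poly N
qint k = ΣP k qpow

qfact : ∀ {N} → ℕ → Poly N
qfact zero = qpow 0
qfact (suc k) = qfact k ⊗ qint (suc k)

elem : ∀ {N} → ℕ → Poly N
elem k α t = if all≤1ᵇ α ∧ (degree α ≡ᵇ k) ∧ (t ≡ᵇ 0) then + 1 else + 0

e₂ : ∀ {N} → ℕ → ℕ → Poly N
e₂ a b = elem a ⊗ elem b

eProd : ∀ {N} → List ℕ → Poly N
eProd [] = qpow 0
eProd (k ∷ ks) = elem k ⊗ eProd ks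

-- Graphs on vertex set [d] = {1,...,d}; edge u v is consulted only
-- for 1 ≤ u < v ≤ d and says whether {u,v} is an edge.

record Graph : Set where
  field
    size : ℕ
    edge : ℕ → ℕ → Bool
open Graph public

pairsOf : (d : ℕ) → List (Fin d × Fin d)
pairsOf d = concatMap (λ i → map (λ j → (i , j)) (allFin d)) (allFin d)

-- vertex i : Fin d stands for the integer toℕ i + 1
isEdgeᵇ : (G : Graph) → Fin (size G) × Fin (size G) → Bool
isEdgeᵇ G (i , j) = (toℕ i <ᵇ toℕ j) ∧ edge G (suc (toℕ i)) (suc (toℕ j))

numEdges : Graph → ℕ
numEdges G = countᵇ (isEdgeᵇ G) (pairsOf (size G))

-- colorings with colors 1..N (color c : Fin N stands for toℕ c + 1)
colorings : (N d : ℕ) → List (Vec (Fin N) d)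
colorings N zero = [] ∷ []
colorings N (suc d) = concatMap (λ c → map (c ∷_) (colorings N d)) (allFin N)

properᵇ : ∀ {N} (G : Graph) → Vec (Fin N) (size G) → Bool
properᵇ G κ = countᵇ (λ p → isEdgeᵇ G p ∧ (toℕ (lookup κ (Data.Product.proj₁ p)) ≡ᵇ toℕ (lookup κ (Data.Product.proj₂ p)))) (pairsOf (size G)) ≡ᵇ 0

asc : ∀ {N} (G : Graph) → Vec (Fin N) (size G) → ℕ
asc G κ = countᵇ (λ p → isEdgeᵇ G p ∧ (toℕ (lookup κ (Data.Product.proj₁ p)) <ᵇ toℕ (lookup κ (Data.Product.proj₂ p)))) (pairsOf (size G))

content : ∀ {N d} → Vec (Fin N) d → Mono N
content {N} {d} κ = tabulate (λ c → countᵇ (λ i → toℕ (lookup κ i) ≡ᵇ toℕ c) (allFin d))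

X : ∀ {N} → Graph → Poly N
X {N} G α t = + countᵇ (λ κ → properᵇ G κ ∧ monoEqᵇ (content κ) α ∧ (asc G κ ≡ᵇ t)) (colorings N (size G))

Lollipop : ℕ → ℕ → Graph
Lollipop r j = record
  { size = r ℕ.+ j
  ; edge = λ u v → ((v ≡ᵇ suc u) ∧ (u ≤ᵇ j)) ∨ ((suc j ≤ᵇ u) ∧ (v ≤ᵇ j ℕ.+ r))
  }

KrL : ℕ → ℕ → ℕ → Graph
KrL r m n = record
  { size = n ℕ.+ m ℕ.+ r ℕ.∸ 1
  ; edge = λ u v → (v ≤ᵇ r)
                 ∨ ((r ≤ᵇ u) ∧ (v ≡ᵇ suc u) ∧ (suc u ≤ᵇ r ℕ.+ n))
                 ∨ ((r ℕ.+ n ≤ᵇ u) ∧ (v ≤ᵇ r ℕ.+ n ℕ.+ m ℕ.∸ 1))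
  }

SymN : ℕ → Set
SymN N = Mono N → ℤ

-- nonnegative (integer) combination of e_λ's
EPosSym : ∀ {N} → SymN N → Set
EPosSym {N} s = ∃ λ (L : List (List ℕ)) → ∀ α → s α ≡ sumℤ (map (λ λs → eProd λs α 0) L)

EPositive : ∀ {N} → Poly N → Set
EPositive f = ∀ t → EPosSym (λ α → f α t)

-- e-unimodal with center of symmetry c, where c2 = 2c
EUnimodal : ∀ {N} → Poly N → ℕ → Set
EUnimodal f c2 =
  (∀ t α → t ℕ.≤ c2 → f α t ≡ f α (c2 ℕ.∸ t))
  × (∀ t α → c2 ℕ.< t → f α t ≡ + 0)
  × (∀ t → suc (2 ℕ.* t) ℕ.< c2 → EPosSym (λ α → f α (suc t) - f α t))

{-# OPTIONS --safe #-}
module Submission where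

-- Sum over colorings from the first vertex on. Write φ c c′ for the weight of an edge colored c, c′ in this
-- order (q for an ascent, 1 for a descent, 0 if c = c′), F k c = e_k(x φ(c,·)) and F′ k c = e_k(x φ(·,c)).
-- Since Σ_c y_c e_k(y φ(c,·)) = [k+1] e_{k+1}(y), a clique K_{k+1} glued at a vertex of color c contributes
-- [k]! F k c on its right and [k]! F′ k c on its left. A path edge acts by T f c = Σ_i φ(c,i) x_i f(i), and
-- T (F k) = q [k] e_{k+1} + F (k+1). Hence X(K_{a+1} + L_{k+1,n}) = [a]! [k]! B a n k, where
-- B a n k = Σ_c x_c F′ a c (Tⁿ (F k)) c. Computing B a (n+1) k with one T applied to F k, or with its adjoint
-- applied to F′ a, yields two recursions, which give the symmetry B a n k = B k n a (identifying
-- X(K_{a+1} + P_j) with the lollipop L_{a+1,j}), the closed form of B a 0 b, and the expansion of B a n k.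
-- The same recursions write X as a sum of terms q^a [b] e_λ with 2a + b = |E| + 1, each of which is
-- e-positive and e-unimodal about |E|/2.

-- The expansion of `B` produces a clique followed by a path, while a lollipop is a path followed by
-- a clique. Reversing the labels turns ascents into descents, and reversing the colors repairs this
-- only up to reversing the variables; the symmetry of `B` supplies the missing identity without
-- first proving that X is a symmetric function. The indices `d ∸ 2 * i` are truncated, so the
-- closed form is stated for `a ≤ b`, which r ≤ m provides. For the same reason differences of
-- products of q-integers never occur as such: the larger product is written as the smaller one plus
-- an explicit surplus, and common terms are cancelled. Positivity and unimodality are not read off
-- the final formula, whose lollipop factors would need the same argument; they are carried along
-- the recursion for `B`, where every coefficient is of the right kind. Polynomials are coefficient
-- functions compared pointwise, so the ring laws for `_⊗_` have to be established before the
-- algebra applies to them.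

open import Defs
open import Algebra.Bundles using (CommutativeRing; Monoid; RawRing)
import Algebra.Construct.Pointwise as Pointwise
import Algebra.Morphism.RingMonomorphism as RingMonomorphism
open import Algebra.Morphism.Structures using (IsRingMonomorphism)
open import Algebra.Structures using (IsCommutativeRing)
open import Data.Bool using (Bool; true; false; _∧_; _∨_; if_then_else_)
open import Data.Bool.Properties using (∧-zeroʳ; ∨-identityʳ; T-≡)
open import Data.Fin using (Fin; zero; suc; toℕ)
open import Data.Fin.Properties using (toℕ<n)
open import Data.Integer as ℤ using (ℤ; +_)
import Data.Integer.Properties as ℤ
import Data.Integer.Solver as ℤSolver
open import Data.List as List using (List; []; _∷_; map; upTo; concatMap; allFin)
import Data.List.Properties as List
open import Data.Nat as ℕ using (ℕ; zero; suc; _≡ᵇ_; _<ᵇ_; s≤s)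
import Data.Nat.Properties as ℕ
open import Data.Nat.Solver using (module +-*-Solver)
open import Data.Product using (_×_; _,_; proj₁; proj₂)
open import Data.Sum using (inj₁; inj₂)
open import Data.Vec as Vec using (Vec; []; _∷_; lookup; tabulate)
open import Data.Vec.Functional using (Vector)
import Data.Vec.Properties as Vec
open import Function using (_∘_; id; Equivalence)
open import Level using (_⊔_; 0ℓ)
open import Relation.Nullary using (contradiction; yes; no)
import Relation.Binary.PropositionalEquality as ≡
open ≡ using (_≡_)

-- Elementary symmetric functions and the transfer operator

-- Vertices are counted from 0: a clique on 0,…,a, a path a,…,a+n, and a clique on all vertices ≥ a+n.
chain : ℕ → ℕ → ℕ → ℕ → Bool
chain a n i zero = false
chain (suc a) n zero (suc j) = j ℕ.<ᵇ suc a
chain (suc a) n (suc i) (suc j) = chain a n i j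
chain zero (suc n) zero (suc j) = j ℕ.<ᵇ 1
chain zero (suc n) (suc i) (suc j) = chain zero n i j
chain zero zero i (suc j) = true

module Interaction {c ℓ} (R : CommutativeRing c ℓ) (q : CommutativeRing.Carrier R) where
  open CommutativeRing R hiding (zero)
  open import Algebra.Properties.Semiring.Sum semiring
  open import Algebra.Properties.Semiring.Exp semiring using (_^_)
  open import Algebra.Properties.AbelianGroup +-abelianGroup using (∙-cancelʳ)
  open import Algebra.Solver.Ring.NaturalCoefficients.Default commutativeSemiring using (solve; _:=_; _:+_; _:*_; con)
  open import Relation.Binary.Reasoning.Setoid setoid

  -- q-integers and q-factorials

  [_] : ℕ → Carrier
  [ zero ] = 0#
  [ suc k ] = 1# + q * [ k ]

  []! : ℕ → Carrier
  []! zero = 1#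
  []! (suc k) = []! k * [ suc k ]

  []-+ : ∀ a b → [ a ℕ.+ b ] ≈ [ a ] + q ^ a * [ b ]
  []-+ zero b = solve 1 (λ x → x := con 0 :+ con 1 :* x) refl [ b ]
  []-+ (suc a) b = trans (+-congˡ (*-congˡ ([]-+ a b)))
    (solve 4 (λ x s p t → con 1 :+ x :* (s :+ p :* t) := con 1 :+ x :* s :+ x :* p :* t) refl q [ a ] (q ^ a) [ b ])

  []-suc : ∀ k → [ suc k ] ≈ [ k ] + q ^ k
  []-suc k = begin
    [ suc k ]               ≡⟨ ≡.cong [_] (ℕ.+-comm 1 k) ⟩
    [ k ℕ.+ 1 ]             ≈⟨ []-+ k 1 ⟩
    [ k ] + q ^ k * [ 1 ]   ≈⟨ solve 3 (λ x s p → s :+ p :* (con 1 :+ x :* con 0) := s :+ p) refl q [ k ] (q ^ k) ⟩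
    [ k ] + q ^ k           ∎

  -- The product splits off its longest interval of exponents and leaves `q` times a product of two
  -- shorter factors. Iterated, this writes a product of q-integers as a sum of intervals with a
  -- common centre, which is how `[]*-block` uses it.
  []-* : ∀ a b → [ suc a ] * [ suc b ] ≈ [ suc (a ℕ.+ b) ] + q * ([ a ] * [ b ])
  []-* a b = begin
    [ suc a ] * [ suc b ]                            ≈⟨ *-cong ([]-suc a) refl ⟩
    ([ a ] + q ^ a) * (1# + q * [ b ])
      ≈⟨ solve 4 (λ x s p t → (s :+ p) :* (con 1 :+ x :* t) := s :+ p :+ x :* p :* t :+ x :* (s :* t)) refl q [ a ] (q ^ a) [ b ] ⟩
    [ a ] + q ^ a + q * q ^ a * [ b ] + q * ([ a ] * [ b ])
      ≈⟨ +-congʳ (+-congʳ ([]-suc a)) ⟨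
    [ suc a ] + q * q ^ a * [ b ] + q * ([ a ] * [ b ]) ≈⟨ +-congʳ ([]-+ (suc a) b) ⟨
    [ suc (a ℕ.+ b) ] + q * ([ a ] * [ b ])          ∎

  -- The surplus `q ^ a * [ j ]` becomes, up to a factor `q`, the coefficient gained when a vertex
  -- passes from one clique to the other in `B-descent`.
  []-exchange : ∀ a j → [ a ℕ.+ j ] * [ suc a ] ≈ [ a ] * [ suc (a ℕ.+ j) ] + q ^ a * [ j ]
  []-exchange a j = begin
    [ a ℕ.+ j ] * [ suc a ]             ≈⟨ *-congʳ ([]-+ a j) ⟩
    ([ a ] + q ^ a * [ j ]) * [ suc a ]
      ≈⟨ solve 4 (λ x s p t → (s :+ p :* t) :* (con 1 :+ x :* s) := s :* (con 1 :+ x :* s :+ x :* p :* t) :+ p :* t) refl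
           q [ a ] (q ^ a) [ j ] ⟩
    [ a ] * ([ suc a ] + q ^ suc a * [ j ]) + q ^ a * [ j ]  ≈⟨ +-congʳ (*-congˡ ([]-+ (suc a) j)) ⟨
    [ a ] * [ suc (a ℕ.+ j) ] + q ^ a * [ j ]  ∎

  ∑< : ℕ → (ℕ → Carrier) → Carrier
  ∑< zero f = 0#
  ∑< (suc n) f = ∑< n f + f n

  ∑<-cong : ∀ n {f g : ℕ → Carrier} → (∀ i → i ℕ.< n → f i ≈ g i) → ∑< n f ≈ ∑< n g
  ∑<-cong zero h = refl
  ∑<-cong (suc n) h = +-cong (∑<-cong n (λ i i<n → h i (ℕ.m≤n⇒m≤1+n i<n))) (h n ℕ.≤-refl)

  *-distribˡ-∑< : ∀ n a (f : ℕ → Carrier) → a * ∑< n f ≈ ∑< n (λ i → a * f i)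
  *-distribˡ-∑< zero a f = zeroʳ a
  *-distribˡ-∑< (suc n) a f = trans (distribˡ a _ _) (+-congʳ (*-distribˡ-∑< n a f))

  -- Recursion on both colors lets the smallest color be peeled off by computation: from it every
  -- other color is an ascent, and from every other color it is a descent. The inductions on the
  -- alphabet below rely on this.
  φ : ∀ {N} → Fin N → Fin N → Carrier
  φ zero zero = 0#
  φ zero (suc j) = q
  φ (suc i) zero = 1#
  φ (suc i) (suc j) = φ i j

  e : ∀ {N} → Vector Carrier N → ℕ → Carrier
  e y zero = 1#
  e {zero} y (suc k) = 0#
  e {suc N} y (suc k) = e (y ∘ suc) (suc k) + y zero * e (y ∘ suc) k

  e-cong : ∀ {N} {y y′ : Vector Carrier N} → (∀ i → y i ≈ y′ i) → ∀ k → e y k ≈ e y′ k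
  e-cong h zero = refl
  e-cong {zero} h (suc k) = refl
  e-cong {suc N} h (suc k) = +-cong (e-cong (h ∘ suc) (suc k)) (*-cong (h zero) (e-cong (h ∘ suc) k))

  e-scale : ∀ {N} (y : Vector Carrier N) k → e (λ i → y i * q) k ≈ q ^ k * e y k
  e-scale y zero = solve 0 (con 1 := con 1 :* con 1) refl
  e-scale {zero} y (suc k) = sym (zeroʳ _)
  e-scale {suc N} y (suc k) =
    trans (+-cong (e-scale (y ∘ suc) (suc k)) (*-congˡ (e-scale (y ∘ suc) k)))
      (solve 5 (λ x p y a b → x :* p :* a :+ y :* x :* (p :* b) := x :* p :* (a :+ y :* b)) refl
        q (q ^ k) (y zero) (e (y ∘ suc) (suc k)) (e (y ∘ suc) k))

  module _ {N : ℕ} where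

    above below : Vector Carrier N → Fin N → Vector Carrier N
    above y c i = y i * φ c i
    below y c i = y i * φ i c

    F F′ : Vector Carrier N → ℕ → Fin N → Carrier
    F y k c = e (above y c) k
    F′ y k c = e (below y c) k

    T T′ : Vector Carrier N → (Fin N → Carrier) → Fin N → Carrier
    T y f c = sum (λ i → φ c i * y i * f i)
    T′ y f c = sum (λ i → φ i c * y i * f i)

  sum-split : ∀ {N} (w A B : Fin N → Carrier) s →
    sum (λ c → w c * (A c + s * B c)) ≈ sum (λ c → w c * A c) + s * sum (λ c → w c * B c)
  sum-split w A B s = begin
    sum (λ c → w c * (A c + s * B c))
      ≈⟨ sum-cong-≋ (λ c → solve 4 (λ w a b s → w :* (a :+ s :* b) := w :* a :+ s :* (w :* b)) refl (w c) (A c) (B c) s) ⟩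
    sum (λ c → w c * A c + s * (w c * B c))              ≈⟨ ∑-distrib-+ (λ c → w c * A c) _ ⟩
    sum (λ c → w c * A c) + sum (λ c → s * (w c * B c))  ≈⟨ +-congˡ (*-distribˡ-sum s (λ c → w c * B c)) ⟨
    sum (λ c → w c * A c) + s * sum (λ c → w c * B c)    ∎

  -- Since `φ c c` is zero, the sum runs over (k+1)-sets S with a marked element c, weighted by `q`
  -- to the number of elements of S above c. As c runs through S, these exponents are 0, ..., k.
  sum-F : ∀ {N} (y : Vector Carrier N) k → sum (λ c → y c * F y k c) ≈ [ suc k ] * e y (suc k)
  sum-F {zero} y k = sym (zeroʳ _)
  sum-F {suc N} y zero = trans (+-congˡ (sum-F (y ∘ suc) zero))
    (solve 3 (λ x y a → y :* con 1 :+ (con 1 :+ x :* con 0) :* a := (con 1 :+ x :* con 0) :* (a :+ y :* con 1)) refl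
      q (y zero) (e (y ∘ suc) 1))
  sum-F {suc N} y (suc k) = begin
    -- The first summand is the smallest color as c: all other variables are scaled by `q`, and its
    -- own variable is removed by the factor `0#`, so the value of `D` is irrelevant.
    y₀ * (e (λ i → y′ i * q) (suc k) + y₀ * 0# * e (λ i → y′ i * q) k)
      + sum (λ c → y′ c * (F y′ (suc k) c + y₀ * 1# * F y′ k c))
      ≈⟨ +-cong (*-congˡ (+-congʳ (e-scale y′ (suc k)))) (sum-split y′ _ _ (y₀ * 1#)) ⟩
    y₀ * (p * E₀ + y₀ * 0# * D) + (sum (λ c → y′ c * F y′ (suc k) c) + y₀ * 1# * sum (λ c → y′ c * F y′ k c))
      ≈⟨ +-congˡ (+-cong (trans (sum-F y′ (suc k)) (*-congʳ ([]-suc (suc k)))) (*-congˡ (sum-F y′ k))) ⟩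
    y₀ * (p * E₀ + y₀ * 0# * D) + ((s + p) * E₁ + y₀ * 1# * (s * E₀))
      ≈⟨ solve 6 (λ y p s E₀ E₁ D → y :* (p :* E₀ :+ y :* con 0 :* D) :+ ((s :+ p) :* E₁ :+ y :* con 1 :* (s :* E₀))
           := (s :+ p) :* (E₁ :+ y :* E₀)) refl y₀ p s E₀ E₁ D ⟩
    (s + p) * (E₁ + y₀ * E₀)
      ≈⟨ *-congʳ ([]-suc (suc k)) ⟨
    [ suc (suc k) ] * e y (suc (suc k)) ∎
    where
    y₀ = y zero
    y′ = y ∘ suc
    p = q ^ suc k
    s = [ suc k ]
    E₀ = e y′ (suc k)
    E₁ = e y′ (suc (suc k))
    D = e (λ i → y′ i * q) k

  e-unscaled : ∀ {N} (y : Vector Carrier N) k → e (λ i → y i * 1#) k ≈ e y k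
  e-unscaled y = e-cong (λ i → *-identityʳ (y i))

  -- Mirror image of `sum-F`: the exponent counts the elements of S below c. The smallest color is
  -- still the one peeled off, so now `y zero` is scaled by `q` and the remaining variables stay
  -- unscaled.
  sum-F′ : ∀ {N} (y : Vector Carrier N) k → sum (λ c → y c * F′ y k c) ≈ [ suc k ] * e y (suc k)
  sum-F′ {zero} y k = sym (zeroʳ _)
  sum-F′ {suc N} y zero = trans (+-congˡ (sum-F′ (y ∘ suc) zero))
    (solve 3 (λ x y a → y :* con 1 :+ (con 1 :+ x :* con 0) :* a := (con 1 :+ x :* con 0) :* (a :+ y :* con 1)) refl
      q (y zero) (e (y ∘ suc) 1))
  sum-F′ {suc N} y (suc k) = begin
    y₀ * (e (λ i → y′ i * 1#) (suc k) + y₀ * 0# * e (λ i → y′ i * 1#) k)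
      + sum (λ c → y′ c * (F′ y′ (suc k) c + y₀ * q * F′ y′ k c))
      ≈⟨ +-cong (*-congˡ (+-congʳ (e-unscaled y′ (suc k)))) (sum-split y′ _ _ (y₀ * q)) ⟩
    y₀ * (E₀ + y₀ * 0# * D) + (sum (λ c → y′ c * F′ y′ (suc k) c) + y₀ * q * sum (λ c → y′ c * F′ y′ k c))
      ≈⟨ +-congˡ (+-cong (sum-F′ y′ (suc k)) (*-congˡ (sum-F′ y′ k))) ⟩
    y₀ * (E₀ + y₀ * 0# * D) + ((1# + q * s) * E₁ + y₀ * q * (s * E₀))
      ≈⟨ solve 6 (λ y x s E₀ E₁ D → y :* (E₀ :+ y :* con 0 :* D) :+ ((con 1 :+ x :* s) :* E₁ :+ y :* x :* (s :* E₀))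
           := (con 1 :+ x :* s) :* (E₁ :+ y :* E₀)) refl y₀ q s E₀ E₁ D ⟩
    [ suc (suc k) ] * e y (suc (suc k)) ∎
    where
    y₀ = y zero
    y′ = y ∘ suc
    s = [ suc k ]
    E₀ = e y′ (suc k)
    E₁ = e y′ (suc (suc k))
    D = e (λ i → y′ i * 1#) k

  -- Expand over (k+1)-sets S with a marked element i, and let p be the number of elements of S
  -- above c. Marked elements above c give the exponents 1, ..., p. Those below c give p, ..., k if
  -- c is not in S, and p+1, ..., k if it is. Each S thus contributes `q * [ k ]`, and one extra
  -- `q ^ p` when c is not in S; that extra term is the product of `φ c s` over s in S, hence
  -- belongs to `F y (suc k) c`.
  T-F : ∀ {N} (y : Vector Carrier N) k c → T y (F y k) c ≈ q * [ k ] * e y (suc k) + F y (suc k) c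
  T-F {suc N} y zero zero = begin
    0# * y₀ * 1# + sum (λ i → q * y′ i * 1#)
      ≈⟨ +-congˡ (trans (sum-cong-≋ (λ i → *-assoc q (y′ i) 1#)) (sym (*-distribˡ-sum q (λ i → y′ i * 1#)))) ⟩
    0# * y₀ * 1# + q * sum (λ i → y′ i * 1#)
      ≈⟨ +-congˡ (*-congˡ (sum-F y′ zero)) ⟩
    0# * y₀ * 1# + q * ([ 1 ] * e y′ 1)
      ≈⟨ solve 4 (λ x y a b → con 0 :* y :* con 1 :+ x :* ((con 1 :+ x :* con 0) :* a)
           := x :* con 0 :* b :+ (x :* con 1 :* a :+ y :* con 0 :* con 1)) refl q y₀ (e y′ 1) (e y 1) ⟩
    q * 0# * e y 1 + (q * 1# * e y′ 1 + y₀ * 0# * 1#)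
      ≈⟨ +-congˡ (+-congʳ (e-scale y′ 1)) ⟨
    q * 0# * e y 1 + (e (λ i → y′ i * q) 1 + y₀ * 0# * 1#) ∎
    where
    y₀ = y zero
    y′ = y ∘ suc
  T-F {suc N} y zero (suc c) = begin
    1# * y₀ * 1# + T y′ (F y′ 0) c
      ≈⟨ +-congˡ (T-F y′ 0 c) ⟩
    1# * y₀ * 1# + (q * 0# * e y′ 1 + F y′ 1 c)
      ≈⟨ solve 5 (λ x y a b f → con 1 :* y :* con 1 :+ (x :* con 0 :* a :+ f)
           := x :* con 0 :* b :+ (f :+ y :* con 1 :* con 1)) refl q y₀ (e y′ 1) (e y 1) (F y′ 1 c) ⟩
    q * 0# * e y 1 + (F y′ 1 c + y₀ * 1# * 1#) ∎
    where
    y₀ = y zero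
    y′ = y ∘ suc
  T-F {suc N} y (suc k) zero = begin
    0# * y₀ * D + sum (λ i → q * y′ i * (F y′ (suc k) i + y₀ * 1# * F y′ k i))
      ≈⟨ +-congˡ (trans (sum-cong-≋ (λ i → *-assoc q (y′ i) _)) (sym (*-distribˡ-sum q (λ i → y′ i * (F y′ (suc k) i + y₀ * 1# * F y′ k i))))) ⟩
    0# * y₀ * D + q * sum (λ i → y′ i * (F y′ (suc k) i + y₀ * 1# * F y′ k i))
      ≈⟨ +-congˡ (*-congˡ (trans (sum-split y′ _ _ (y₀ * 1#))
           (+-cong (trans (sum-F y′ (suc k)) (*-congʳ ([]-suc (suc k)))) (*-congˡ (sum-F y′ k))))) ⟩
    0# * y₀ * D + q * ((s + p) * E₁ + y₀ * 1# * (s * E₀))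
      ≈⟨ solve 8 (λ x y s p E₀ E₁ D D′ → con 0 :* y :* D :+ x :* ((s :+ p) :* E₁ :+ y :* con 1 :* (s :* E₀))
           := x :* s :* (E₁ :+ y :* E₀) :+ (x :* p :* E₁ :+ y :* con 0 :* D′)) refl q y₀ s p E₀ E₁ D D′ ⟩
    q * s * (E₁ + y₀ * E₀) + (q * p * E₁ + y₀ * 0# * D′)
      ≈⟨ +-congˡ (+-congʳ (e-scale y′ (suc (suc k)))) ⟨
    q * s * (E₁ + y₀ * E₀) + (e (λ i → y′ i * q) (suc (suc k)) + y₀ * 0# * D′) ∎
    where
    y₀ = y zero
    y′ = y ∘ suc
    p = q ^ suc k
    s = [ suc k ]
    E₀ = e y′ (suc k)
    E₁ = e y′ (suc (suc k))
    D = F y (suc k) zero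
    D′ = e (λ i → y′ i * q) (suc k)
  T-F {suc N} y (suc k) (suc c) = begin
    1# * y₀ * (e (λ i → y′ i * q) (suc k) + y₀ * 0# * D)
      + sum (λ i → φ c i * y′ i * (F y′ (suc k) i + y₀ * 1# * F y′ k i))
      ≈⟨ +-cong (*-congˡ (+-congʳ (e-scale y′ (suc k))))
           (trans (sum-split (λ i → φ c i * y′ i) _ _ (y₀ * 1#)) (+-cong (T-F y′ (suc k) c) (*-congˡ (T-F y′ k c)))) ⟩
    1# * y₀ * (q * p * E₀ + y₀ * 0# * D) + (q * [ suc k ] * E₁ + f₁ + y₀ * 1# * (q * s * E₀ + f₀))
      ≈⟨ +-congˡ (+-congʳ (+-congʳ (*-congʳ (*-congˡ ([]-suc k))))) ⟩
    1# * y₀ * (q * p * E₀ + y₀ * 0# * D) + (q * (s + p) * E₁ + f₁ + y₀ * 1# * (q * s * E₀ + f₀))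
      ≈⟨ solve 9 (λ x y s p E₀ E₁ D f₀ f₁ →
             con 1 :* y :* (x :* p :* E₀ :+ y :* con 0 :* D) :+ (x :* (s :+ p) :* E₁ :+ f₁ :+ y :* con 1 :* (x :* s :* E₀ :+ f₀))
             := x :* (s :+ p) :* (E₁ :+ y :* E₀) :+ (f₁ :+ y :* con 1 :* f₀)) refl q y₀ s p E₀ E₁ D f₀ f₁ ⟩
    q * (s + p) * (E₁ + y₀ * E₀) + (f₁ + y₀ * 1# * f₀)
      ≈⟨ +-congʳ (*-congʳ (*-congˡ ([]-suc k))) ⟨
    q * [ suc k ] * (E₁ + y₀ * E₀) + (f₁ + y₀ * 1# * f₀) ∎
    where
    y₀ = y zero
    y′ = y ∘ suc
    p = q ^ k
    s = [ k ]
    E₀ = e y′ (suc k)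
    E₁ = e y′ (suc (suc k))
    D = e (λ i → y′ i * q) k
    f₀ = F y′ (suc k) c
    f₁ = F y′ (suc (suc k)) c

  -- The count behind `T-F` with the order of the colors reversed. The induction is carried out anew
  -- because `e` peels its variables off at one end only.
  T′-F′ : ∀ {N} (y : Vector Carrier N) k c → T′ y (F′ y k) c ≈ q * [ k ] * e y (suc k) + F′ y (suc k) c
  T′-F′ {suc N} y zero zero = begin
    0# * y₀ * 1# + sum (λ i → 1# * y′ i * 1#)
      ≈⟨ +-congˡ (trans (sum-cong-≋ (λ i → *-congʳ (*-identityˡ (y′ i)))) (sum-F′ y′ zero)) ⟩
    0# * y₀ * 1# + [ 1 ] * e y′ 1
      ≈⟨ solve 4 (λ x y a b → con 0 :* y :* con 1 :+ (con 1 :+ x :* con 0) :* a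
           := x :* con 0 :* b :+ (a :+ y :* con 0 :* con 1)) refl q y₀ (e y′ 1) (e y 1) ⟩
    q * 0# * e y 1 + (e y′ 1 + y₀ * 0# * 1#)
      ≈⟨ +-congˡ (+-congʳ (e-unscaled y′ 1)) ⟨
    q * 0# * e y 1 + (e (λ i → y′ i * 1#) 1 + y₀ * 0# * 1#) ∎
    where
    y₀ = y zero
    y′ = y ∘ suc
  T′-F′ {suc N} y zero (suc c) = begin
    q * y₀ * 1# + T′ y′ (F′ y′ 0) c
      ≈⟨ +-congˡ (T′-F′ y′ 0 c) ⟩
    q * y₀ * 1# + (q * 0# * e y′ 1 + F′ y′ 1 c)
      ≈⟨ solve 5 (λ x y a b f → x :* y :* con 1 :+ (x :* con 0 :* a :+ f)
           := x :* con 0 :* b :+ (f :+ y :* x :* con 1)) refl q y₀ (e y′ 1) (e y 1) (F′ y′ 1 c) ⟩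
    q * 0# * e y 1 + (F′ y′ 1 c + y₀ * q * 1#) ∎
    where
    y₀ = y zero
    y′ = y ∘ suc
  T′-F′ {suc N} y (suc k) zero = begin
    0# * y₀ * D + sum (λ i → 1# * y′ i * (F′ y′ (suc k) i + y₀ * q * F′ y′ k i))
      ≈⟨ +-congˡ (sum-cong-≋ (λ i → *-congʳ (*-identityˡ (y′ i)))) ⟩
    0# * y₀ * D + sum (λ i → y′ i * (F′ y′ (suc k) i + y₀ * q * F′ y′ k i))
      ≈⟨ +-congˡ (trans (sum-split y′ _ _ (y₀ * q)) (+-cong (sum-F′ y′ (suc k)) (*-congˡ (sum-F′ y′ k)))) ⟩
    0# * y₀ * D + ((1# + q * s) * E₁ + y₀ * q * (s * E₀))
      ≈⟨ solve 7 (λ x y s E₀ E₁ D D′ → con 0 :* y :* D :+ ((con 1 :+ x :* s) :* E₁ :+ y :* x :* (s :* E₀))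
           := x :* s :* (E₁ :+ y :* E₀) :+ (E₁ :+ y :* con 0 :* D′)) refl q y₀ s E₀ E₁ D D′ ⟩
    q * s * (E₁ + y₀ * E₀) + (E₁ + y₀ * 0# * D′)
      ≈⟨ +-congˡ (+-congʳ (e-unscaled y′ (suc (suc k)))) ⟨
    q * s * (E₁ + y₀ * E₀) + (e (λ i → y′ i * 1#) (suc (suc k)) + y₀ * 0# * D′) ∎
    where
    y₀ = y zero
    y′ = y ∘ suc
    s = [ suc k ]
    E₀ = e y′ (suc k)
    E₁ = e y′ (suc (suc k))
    D = F′ y (suc k) zero
    D′ = e (λ i → y′ i * 1#) (suc k)
  T′-F′ {suc N} y (suc k) (suc c) = begin
    q * y₀ * (e (λ i → y′ i * 1#) (suc k) + y₀ * 0# * D)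
      + sum (λ i → φ i c * y′ i * (F′ y′ (suc k) i + y₀ * q * F′ y′ k i))
      ≈⟨ +-cong (*-congˡ (+-congʳ (e-unscaled y′ (suc k))))
           (trans (sum-split (λ i → φ i c * y′ i) _ _ (y₀ * q)) (+-cong (T′-F′ y′ (suc k) c) (*-congˡ (T′-F′ y′ k c)))) ⟩
    q * y₀ * (E₀ + y₀ * 0# * D) + (q * (1# + q * s) * E₁ + f₁ + y₀ * q * (q * s * E₀ + f₀))
      ≈⟨ solve 8 (λ x y s E₀ E₁ D f₀ f₁ →
             x :* y :* (E₀ :+ y :* con 0 :* D) :+ (x :* (con 1 :+ x :* s) :* E₁ :+ f₁ :+ y :* x :* (x :* s :* E₀ :+ f₀))
             := x :* (con 1 :+ x :* s) :* (E₁ :+ y :* E₀) :+ (f₁ :+ y :* x :* f₀)) refl q y₀ s E₀ E₁ D f₀ f₁ ⟩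
    q * (1# + q * s) * (E₁ + y₀ * E₀) + (f₁ + y₀ * q * f₀) ∎
    where
    y₀ = y zero
    y′ = y ∘ suc
    s = [ k ]
    E₀ = e y′ (suc k)
    E₁ = e y′ (suc (suc k))
    D = e (λ i → y′ i * 1#) k
    f₀ = F′ y′ (suc k) c
    f₁ = F′ y′ (suc (suc k)) c

  sum-scale : ∀ {N} a (f g : Fin N → Carrier) → (∀ c → f c ≈ a * g c) → sum f ≈ a * sum g
  sum-scale a f g h = trans (sum-cong-≋ h) (sym (*-distribˡ-sum a g))

  -- Weighted coloring sums

  link : ∀ {N} → Bool → Fin N → Fin N → Carrier
  link b c c′ = if b then φ c c′ else 1#

  -- `Y j c` is the weight of giving vertex j the color c, including the edges to vertices already
  -- colored. Coloring vertex 0 moves its edges into the weights of its neighbors, so what remains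
  -- is a sum of the same kind on one vertex fewer.
  coloringSum : ∀ {N} (d : ℕ) → (ℕ → ℕ → Bool) → (ℕ → Vector Carrier N) → Carrier
  coloringSum zero E Y = 1#
  coloringSum (suc d) E Y = sum (λ c → Y 0 c * coloringSum d (λ i j → E (suc i) (suc j)) (λ j c′ → Y (suc j) c′ * link (E 0 (suc j)) c c′))

  coloringSum-cong : ∀ {N} d {E E′} {Y Y′ : ℕ → Vector Carrier N} →
    (∀ {i j} → i ℕ.< j → j ℕ.< d → E i j ≡ E′ i j) → (∀ {j} → j ℕ.< d → ∀ c → Y j c ≈ Y′ j c) →
    coloringSum d E Y ≈ coloringSum d E′ Y′
  coloringSum-cong zero hE hY = refl
  coloringSum-cong (suc d) hE hY = sum-cong-≋ (λ c → *-cong (hY ℕ.z<s c)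
    (coloringSum-cong d (λ i<j j<d → hE (ℕ.s<s i<j) (ℕ.s<s j<d))
      (λ j<d c′ → *-cong (hY (ℕ.s<s j<d) c′) (reflexive (≡.cong (λ b → link b c c′) (hE ℕ.z<s (ℕ.s<s j<d)))))))

  -- In a clique the remaining vertices always share one weight function; coloring a vertex only
  -- changes the alphabet from `y` to `above y c`, and `sum-F` evaluates the outer sum.
  coloringSum-clique : ∀ {N} d (y : Vector Carrier N) → coloringSum d (λ i j → true) (λ j → y) ≈ []! d * e y d
  coloringSum-clique zero y = sym (*-identityˡ 1#)
  coloringSum-clique (suc d) y = begin
    sum (λ c → y c * coloringSum d (λ i j → true) (λ j → above y c))
      ≈⟨ sum-scale ([]! d) _ (λ c → y c * F y d c) (λ c → trans (*-congˡ (coloringSum-clique d (above y c)))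
           (solve 3 (λ y p z → y :* (p :* z) := p :* (y :* z)) refl (y c) ([]! d) (F y d c))) ⟩
    []! d * sum (λ c → y c * F y d c)    ≈⟨ *-congˡ (sum-F y d) ⟩
    []! d * ([ suc d ] * e y (suc d))    ≈⟨ *-assoc _ _ _ ⟨
    []! (suc d) * e y (suc d)            ∎

  -- Iterated transfer, the form `B` and its recursions

  module _ {N : ℕ} (x : Vector Carrier N) where

    Tⁿ : ℕ → (Fin N → Carrier) → Fin N → Carrier
    Tⁿ zero f = f
    Tⁿ (suc n) f = T x (Tⁿ n f)

    T-cong : ∀ {f g : Fin N → Carrier} → (∀ c → f c ≈ g c) → ∀ c → T x f c ≈ T x g c
    T-cong h c = sum-cong-≋ (λ i → *-congˡ (h i))

    T-linear : ∀ (a : Carrier) (f g : Fin N → Carrier) c →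
      T x (λ i → a * f i + g i) c ≈ a * T x f c + T x g c
    T-linear a f g c = begin
      T x (λ i → a * f i + g i) c
        ≈⟨ sum-cong-≋ (λ i → *-congˡ (+-comm (a * f i) (g i))) ⟩
      sum (λ i → φ c i * x i * (g i + a * f i))  ≈⟨ sum-split (λ i → φ c i * x i) g f a ⟩
      T x g c + a * T x f c                      ≈⟨ +-comm _ _ ⟩
      a * T x f c + T x g c                      ∎

    -- `T-F` acts on the innermost application of `T`. Its constant term is a multiple of `F x 0`,
    -- which is the constant function 1, so the outer applications extend by linearity.
    Tⁿ-F : ∀ n k c → Tⁿ (suc n) (F x k) c ≈ q * [ k ] * e x (suc k) * Tⁿ n (F x 0) c + Tⁿ n (F x (suc k)) c
    Tⁿ-F zero k c = trans (T-F x k c) (+-congʳ (sym (*-identityʳ _)))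
    Tⁿ-F (suc n) k c = trans (T-cong (Tⁿ-F n k) c) (T-linear _ (Tⁿ n (F x 0)) (Tⁿ n (F x (suc k))) c)

    ⟨_,_⟩ : (f g : Fin N → Carrier) → Carrier
    ⟨ f , g ⟩ = sum (λ c → x c * (f c * g c))

    ⟨⟩-cong : ∀ {f f′ g g′ : Fin N → Carrier} → (∀ c → f c ≈ f′ c) → (∀ c → g c ≈ g′ c) → ⟨ f , g ⟩ ≈ ⟨ f′ , g′ ⟩
    ⟨⟩-cong h h′ = sum-cong-≋ (λ c → *-congˡ (*-cong (h c) (h′ c)))

    ⟨⟩-comm : ∀ f g → ⟨ f , g ⟩ ≈ ⟨ g , f ⟩
    ⟨⟩-comm f g = sum-cong-≋ (λ c → *-congˡ (*-comm (f c) (g c)))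

    ⟨⟩-linear : ∀ f a g h → ⟨ f , (λ c → a * g c + h c) ⟩ ≈ a * ⟨ f , g ⟩ + ⟨ f , h ⟩
    ⟨⟩-linear f a g h = begin
      ⟨ f , (λ c → a * g c + h c) ⟩
        ≈⟨ sum-cong-≋ (λ c → solve 5 (λ x f a g h → x :* (f :* (a :* g :+ h)) := (x :* f) :* (h :+ a :* g)) refl (x c) (f c) a (g c) (h c)) ⟩
      sum (λ c → x c * f c * (h c + a * g c))
        ≈⟨ sum-split (λ c → x c * f c) h g a ⟩
      sum (λ c → x c * f c * h c) + a * sum (λ c → x c * f c * g c)
        ≈⟨ +-cong (sum-cong-≋ (λ c → *-assoc (x c) (f c) (h c))) (*-congˡ (sum-cong-≋ (λ c → *-assoc (x c) (f c) (g c)))) ⟩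
      ⟨ f , h ⟩ + a * ⟨ f , g ⟩
        ≈⟨ +-comm _ _ ⟩
      a * ⟨ f , g ⟩ + ⟨ f , h ⟩ ∎

    -- Both sides are the double sum of x_c x_i f(c) φ(c,i) g(i). The factor `x c` in the form
    -- matches the variable carried by `T` and `T′`.
    adjoint : ∀ f g → ⟨ f , T x g ⟩ ≈ ⟨ T′ x f , g ⟩
    adjoint f g = begin
      sum (λ c → x c * (f c * sum (λ i → φ c i * x i * g i)))
        ≈⟨ sum-cong-≋ (λ c → trans (sym (*-assoc (x c) (f c) _)) (*-distribˡ-sum (x c * f c) (λ i → φ c i * x i * g i))) ⟩
      sum (λ c → sum (λ i → x c * f c * (φ c i * x i * g i)))
        ≈⟨ ∑-comm (λ c i → x c * f c * (φ c i * x i * g i)) ⟩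
      sum (λ i → sum (λ c → x c * f c * (φ c i * x i * g i)))
        ≈⟨ sum-cong-≋ (λ i → trans
             (sum-scale (x i * g i) (λ c → x c * f c * (φ c i * x i * g i)) (λ c → φ c i * x c * f c)
               (λ c → solve 5 (λ x f p y g → x :* f :* (p :* y :* g) := y :* g :* (p :* x :* f)) refl (x c) (f c) (φ c i) (x i) (g i)))
             (solve 3 (λ x g s → x :* g :* s := x :* (s :* g)) refl (x i) (g i) (sum (λ c → φ c i * x c * f c)))) ⟩
      sum (λ i → x i * (T′ x f i * g i)) ∎

    B : ℕ → ℕ → ℕ → Carrier
    B a n k = ⟨ F′ x a , Tⁿ n (F x k) ⟩

    -- The path edge next to the right clique disappears in two ways: the clique splits off as the
    -- factor `e x (suc k)` and leaves a bare path end, or it absorbs one vertex of the path.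
    -- `B-stepˡ` does the same at the left clique.
    B-stepʳ : ∀ a n k → B a (suc n) k ≈ q * [ k ] * e x (suc k) * B a n 0 + B a n (suc k)
    B-stepʳ a n k = trans (⟨⟩-cong (λ c → refl) (Tⁿ-F n k)) (⟨⟩-linear (F′ x a) _ (Tⁿ n (F x 0)) (Tⁿ n (F x (suc k))))

    B-stepˡ : ∀ a n k → B a (suc n) k ≈ q * [ a ] * e x (suc a) * B 0 n k + B (suc a) n k
    B-stepˡ a n k = begin
      B a (suc n) k                              ≈⟨ adjoint (F′ x a) g ⟩
      ⟨ T′ x (F′ x a) , g ⟩                      ≈⟨ ⟨⟩-cong T′-F′₁ (λ c → refl) ⟩
      ⟨ (λ c → s * F′ x 0 c + F′ x (suc a) c) , g ⟩ ≈⟨ ⟨⟩-comm _ g ⟩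
      ⟨ g , (λ c → s * F′ x 0 c + F′ x (suc a) c) ⟩ ≈⟨ ⟨⟩-linear g s (F′ x 0) (F′ x (suc a)) ⟩
      s * ⟨ g , F′ x 0 ⟩ + ⟨ g , F′ x (suc a) ⟩  ≈⟨ +-cong (*-congˡ (⟨⟩-comm g (F′ x 0))) (⟨⟩-comm g (F′ x (suc a))) ⟩
      s * B 0 n k + B (suc a) n k                ∎
      where
      g = Tⁿ n (F x k)
      s = q * [ a ] * e x (suc a)
      T′-F′₁ : ∀ c → T′ x (F′ x a) c ≈ s * F′ x 0 c + F′ x (suc a) c
      T′-F′₁ c = trans (T′-F′ x a c) (+-congʳ (sym (*-identityʳ s)))

    B-0-0 : ∀ k → B 0 0 k ≈ [ suc k ] * e x (suc k)
    B-0-0 k = trans (sum-cong-≋ (λ c → *-congˡ (*-identityˡ (F x k c)))) (sum-F x k)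

    B-a-0-0 : ∀ a → B a 0 0 ≈ [ suc a ] * e x (suc a)
    B-a-0-0 a = trans (sum-cong-≋ (λ c → *-congˡ (*-identityʳ (F′ x a c)))) (sum-F′ x a)

    -- Both sides compute ⟨ F′ x a , T x (F x b) ⟩, moving T to the left or not.
    B-exchange : ∀ a b →
      q * ([ a ] * [ suc b ]) * (e x (suc a) * e x (suc b)) + B (suc a) 0 b
        ≈ q * ([ b ] * [ suc a ]) * (e x (suc a) * e x (suc b)) + B a 0 (suc b)
    B-exchange a b = begin
      q * ([ a ] * [ suc b ]) * (e x (suc a) * e x (suc b)) + B (suc a) 0 b
        ≈⟨ +-congʳ (solve 5 (λ x s t c d → x :* (s :* t) :* (c :* d) := x :* s :* c :* (t :* d)) refl
             q [ a ] [ suc b ] (e x (suc a)) (e x (suc b))) ⟩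
      q * [ a ] * e x (suc a) * ([ suc b ] * e x (suc b)) + B (suc a) 0 b
        ≈⟨ +-congʳ (*-congˡ (B-0-0 b)) ⟨
      q * [ a ] * e x (suc a) * B 0 0 b + B (suc a) 0 b
        ≈⟨ B-stepˡ a 0 b ⟨
      B a 1 b
        ≈⟨ B-stepʳ a 0 b ⟩
      q * [ b ] * e x (suc b) * B a 0 0 + B a 0 (suc b)
        ≈⟨ +-congʳ (*-congˡ (B-a-0-0 a)) ⟩
      q * [ b ] * e x (suc b) * ([ suc a ] * e x (suc a)) + B a 0 (suc b)
        ≈⟨ +-congʳ (solve 5 (λ x s t c d → x :* s :* d :* (t :* c) := x :* (s :* t) :* (c :* d)) refl
             q [ b ] [ suc a ] (e x (suc a)) (e x (suc b))) ⟩
      q * ([ b ] * [ suc a ]) * (e x (suc a) * e x (suc b)) + B a 0 (suc b) ∎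

    -- `B-exchange` is applied at (a, b) and, read backwards, at (b, a). The induction hypothesis
    -- joins the two, and the same product term remains on both sides to be cancelled. For `a = 0`
    -- the two values come from `sum-F` and `sum-F′`.
    B-sym₀ : ∀ a b → B a 0 b ≈ B b 0 a
    B-sym₀ zero b = trans (B-0-0 b) (sym (B-a-0-0 b))
    B-sym₀ (suc a) b = ∙-cancelʳ (q * ([ a ] * [ suc b ]) * (E a * E b)) _ _ (begin
      B (suc a) 0 b + q * ([ a ] * [ suc b ]) * (E a * E b)   ≈⟨ +-comm _ _ ⟩
      q * ([ a ] * [ suc b ]) * (E a * E b) + B (suc a) 0 b   ≈⟨ B-exchange a b ⟩
      q * ([ b ] * [ suc a ]) * (E a * E b) + B a 0 (suc b)   ≈⟨ +-cong (*-congˡ (*-comm (E a) (E b))) (B-sym₀ a (suc b)) ⟩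
      q * ([ b ] * [ suc a ]) * (E b * E a) + B (suc b) 0 a   ≈⟨ B-exchange b a ⟩
      q * ([ a ] * [ suc b ]) * (E b * E a) + B b 0 (suc a)   ≈⟨ +-comm _ _ ⟩
      B b 0 (suc a) + q * ([ a ] * [ suc b ]) * (E b * E a)   ≈⟨ +-congˡ (*-congˡ (*-comm (E b) (E a))) ⟩
      B b 0 (suc a) + q * ([ a ] * [ suc b ]) * (E a * E b)   ∎)
      where
      E : ℕ → Carrier
      E k = e x (suc k)

    -- Under the induction hypothesis the right recursion at (a, k) agrees term by term with the
    -- left recursion at (k, a).
    B-sym : ∀ a n k → B a n k ≈ B k n a
    B-sym a zero k = B-sym₀ a k
    B-sym a (suc n) k = begin
      B a (suc n) k                                          ≈⟨ B-stepʳ a n k ⟩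
      q * [ k ] * e x (suc k) * B a n 0 + B a n (suc k)      ≈⟨ +-cong (*-congˡ (B-sym a n 0)) (B-sym a n (suc k)) ⟩
      q * [ k ] * e x (suc k) * B 0 n a + B (suc k) n a      ≈⟨ B-stepˡ k n a ⟨
      B k (suc n) a                                          ∎

    -- Writing the right parameter as `a + j` makes the difference of the two products in
    -- `B-exchange` a polynomial with nonnegative coefficients. The new term is the summand
    -- `i = suc a` of the closed form, where `d ∸ 2 * i` is `j`.
    B-descent : ∀ a j → B (suc a) 0 (a ℕ.+ j) ≈ B a 0 (suc (a ℕ.+ j)) + q ^ suc a * [ j ] * (e x (suc (a ℕ.+ j)) * e x (suc a))
    B-descent a j = ∙-cancelʳ (q * ([ a ] * [ suc b ]) * (Ea * Eb)) _ _ (begin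
      B (suc a) 0 b + q * ([ a ] * [ suc b ]) * (Ea * Eb)     ≈⟨ +-comm _ _ ⟩
      q * ([ a ] * [ suc b ]) * (Ea * Eb) + B (suc a) 0 b     ≈⟨ B-exchange a b ⟩
      q * ([ b ] * [ suc a ]) * (Ea * Eb) + B a 0 (suc b)     ≈⟨ +-congʳ (*-congʳ (*-congˡ ([]-exchange a j))) ⟩
      q * ([ a ] * [ suc b ] + q ^ a * [ j ]) * (Ea * Eb) + B a 0 (suc b)
        ≈⟨ solve 7 (λ x s p t c d z → x :* (s :+ p :* t) :* (c :* d) :+ z
             := z :+ x :* p :* t :* (d :* c) :+ x :* s :* (c :* d)) refl q ([ a ] * [ suc b ]) (q ^ a) [ j ] Ea Eb (B a 0 (suc b)) ⟩
      B a 0 (suc b) + q ^ suc a * [ j ] * (Eb * Ea) + q * ([ a ] * [ suc b ]) * (Ea * Eb) ∎)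
      where
      b = a ℕ.+ j
      Ea = e x (suc a)
      Eb = e x (suc b)

    -- Vertices are moved from the left clique to the right one by `B-descent` until the left clique
    -- is a single vertex. The condition `a ≤ b` survives each move.
    B-closed : ∀ a b → a ℕ.≤ b → ∀ {d} → suc (a ℕ.+ b) ≡ d →
      B a 0 b ≈ ∑< (suc a) (λ i → q ^ i * [ d ℕ.∸ 2 ℕ.* i ] * (e x (d ℕ.∸ i) * e x i))
    B-closed zero b _ ≡.refl = trans (B-0-0 b)
      (solve 2 (λ s t → s :* t := con 0 :+ con 1 :* s :* (t :* con 1)) refl [ suc b ] (e x (suc b)))
    B-closed (suc a) b a<b {d} a+b≡d with b ℕ.∸ a | ℕ.m+[n∸m]≡n (ℕ.<⇒≤ a<b)
    ... | j | ≡.refl = trans (B-descent a j) (+-cong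
      (B-closed a (suc (a ℕ.+ j)) (ℕ.m≤n⇒m≤1+n (ℕ.m≤m+n a j)) (≡.trans (≡.cong suc (ℕ.+-suc a (a ℕ.+ j))) a+b≡d))
      (reflexive (≡.cong₂ (λ u v → q ^ suc a * [ u ] * (e x v * e x (suc a))) (index₁ d a+b≡d) (index₂ d a+b≡d))))
      where
      index₂ : ∀ d → suc (suc a ℕ.+ (a ℕ.+ j)) ≡ d → suc (a ℕ.+ j) ≡ d ℕ.∸ suc a
      index₂ d ≡.refl = ≡.sym (≡.trans (≡.cong (ℕ._∸ a) (≡.sym (ℕ.+-suc a (a ℕ.+ j)))) (ℕ.m+n∸m≡n a (suc (a ℕ.+ j))))
      index₁ : ∀ d → suc (suc a ℕ.+ (a ℕ.+ j)) ≡ d → j ≡ d ℕ.∸ 2 ℕ.* suc a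
      index₁ d ≡.refl = ≡.sym (≡.trans (≡.cong (ℕ._∸ 2 ℕ.* suc a) lhs) (ℕ.m+n∸m≡n (2 ℕ.* suc a) j))
        where
        lhs : suc (suc a ℕ.+ (a ℕ.+ j)) ≡ 2 ℕ.* suc a ℕ.+ j
        lhs = ≡.cong suc (≡.trans (≡.cong suc (≡.sym (ℕ.+-assoc a a j)))
                (≡.cong (ℕ._+ j) (≡.trans (≡.sym (ℕ.+-suc a a)) (≡.cong (λ z → a ℕ.+ suc z) (≡.sym (ℕ.+-identityʳ a))))))

    -- Iteration of `B-stepʳ`. Each application yields a split-off term and enlarges the right
    -- clique; `j` is the length of the path that remains after the split. The first application
    -- therefore gives the last summand, and `n + k` stays fixed in the others.
    B-expand : ∀ a n k → B a n k ≈ B a 0 (n ℕ.+ k)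
      + ∑< n (λ j → q * [ n ℕ.+ suc k ℕ.∸ j ℕ.∸ 2 ] * B a j 0 * e x (n ℕ.+ suc k ℕ.∸ j ℕ.∸ 1))
    B-expand a zero k = sym (+-identityʳ _)
    B-expand a (suc n) k = begin
      B a (suc n) k                                       ≈⟨ B-stepʳ a n k ⟩
      q * [ k ] * e x (suc k) * B a n 0 + B a n (suc k)   ≈⟨ +-congˡ (B-expand a n (suc k)) ⟩
      q * [ k ] * e x (suc k) * B a n 0 + (B a 0 (n ℕ.+ suc k) + ∑< n (term (n ℕ.+ suc (suc k))))
        ≈⟨ solve 6 (λ x s E b z t → x :* s :* E :* b :+ (z :+ t) := z :+ (t :+ x :* s :* b :* E)) refl
             q [ k ] (e x (suc k)) (B a n 0) (B a 0 (n ℕ.+ suc k)) (∑< n (term (n ℕ.+ suc (suc k)))) ⟩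
      B a 0 (n ℕ.+ suc k) + (∑< n (term (n ℕ.+ suc (suc k))) + q * [ k ] * B a n 0 * e x (suc k))
        ≡⟨ ≡.cong₂ (λ u v → B a 0 u + (∑< n (term v) + q * [ k ] * B a n 0 * e x (suc k))) (ℕ.+-suc n k) (ℕ.+-suc n (suc k)) ⟩
      B a 0 (suc n ℕ.+ k) + (∑< n (term (suc n ℕ.+ suc k)) + q * [ k ] * B a n 0 * e x (suc k))
        ≡⟨ ≡.cong (λ u → B a 0 (suc n ℕ.+ k) + (∑< n (term (suc n ℕ.+ suc k)) + q * [ u ℕ.∸ 2 ] * B a n 0 * e x (u ℕ.∸ 1))) last-index ⟩
      B a 0 (suc n ℕ.+ k) + ∑< (suc n) (term (suc n ℕ.+ suc k)) ∎
      where
      term : ℕ → ℕ → Carrier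
      term m j = q * [ m ℕ.∸ j ℕ.∸ 2 ] * B a j 0 * e x (m ℕ.∸ j ℕ.∸ 1)
      last-index : suc (suc k) ≡ suc n ℕ.+ suc k ℕ.∸ n
      last-index = ≡.sym (≡.trans (≡.cong (ℕ._∸ n) (≡.sym (ℕ.+-suc n (suc k)))) (ℕ.m+n∸m≡n n (suc (suc k))))

    -- Earlier vertices change the weights only on the clique or edge that contains the current
    -- first vertex. This two-valued family is therefore stable under removing that vertex, which
    -- the inductions on `a` and on `n` need.
    weights : ℕ → Vector Carrier N → ℕ → Vector Carrier N
    weights a y j = if j ℕ.<ᵇ suc a then y else x

    coloringSum-path : ∀ n k y →
      coloringSum (suc (n ℕ.+ k)) (chain 0 n) (weights 0 y) ≈ sum (λ c → y c * ([]! k * Tⁿ n (F x k) c))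
    coloringSum-path zero k y = sum-cong-≋ (λ c → *-congˡ
      (coloringSum-clique k (above x c)))
    coloringSum-path (suc n) k y = sum-cong-≋ (λ c → *-congˡ (begin
      coloringSum (suc (n ℕ.+ k)) (chain 0 n) (λ j c′ → x c′ * link (j ℕ.<ᵇ 1) c c′)
        ≈⟨ coloringSum-cong (suc (n ℕ.+ k)) {E = chain 0 n} (λ _ _ → ≡.refl) (λ {j} _ → next c j) ⟩
      coloringSum (suc (n ℕ.+ k)) (chain 0 n) (weights 0 (above x c))
        ≈⟨ coloringSum-path n k (above x c) ⟩
      sum (λ i → x i * φ c i * ([]! k * Tⁿ n (F x k) i))
        ≈⟨ sum-scale ([]! k) _ (λ i → φ c i * x i * Tⁿ n (F x k) i)
             (λ i → solve 4 (λ x p b t → x :* p :* (b :* t) := b :* (p :* x :* t)) refl (x i) (φ c i) ([]! k) (Tⁿ n (F x k) i)) ⟩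
      []! k * Tⁿ (suc n) (F x k) c ∎))
      where
      next : ∀ c j c′ → x c′ * link (j ℕ.<ᵇ 1) c c′ ≈ weights 0 (above x c) j c′
      next c zero c′ = refl
      next c (suc j) c′ = *-identityʳ (x c′)

    -- The color c of the vertex where the left clique meets the path is kept fixed. The other
    -- vertices of that clique precede it, hence the factor `F′`, and everything to its right
    -- depends on c alone.
    coloringSum-chain-weighted : ∀ a n k y →
      coloringSum (suc (a ℕ.+ (n ℕ.+ k))) (chain a n) (weights a y)
        ≈ []! a * sum (λ c → y c * (F′ y a c * ([]! k * Tⁿ n (F x k) c)))
    coloringSum-chain-weighted zero n k y = trans (coloringSum-path n k y)
      (sum-scale 1# _ (λ c → y c * (1# * ([]! k * Tⁿ n (F x k) c)))
        (λ c → solve 2 (λ y z → y :* z := con 1 :* (y :* (con 1 :* z))) refl (y c) ([]! k * Tⁿ n (F x k) c)))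
    coloringSum-chain-weighted (suc a) n k y = begin
      sum (λ i → y i * coloringSum d (chain a n) (λ j c → weights (suc a) y (suc j) c * link (j ℕ.<ᵇ suc a) i c))
        ≈⟨ sum-cong-≋ (λ i → *-congˡ (trans (coloringSum-cong d {E = chain a n} (λ _ _ → ≡.refl) (λ {j} _ → next i j))
             (coloringSum-chain-weighted a n k (above y i)))) ⟩
      sum (λ i → y i * ([]! a * sum (λ c → above y i c * (F′ (above y i) a c * g c))))
        ≈⟨ sum-scale ([]! a) _ (λ i → sum (λ c → y i * (above y i c * (F′ (above y i) a c * g c))))
             (λ i → trans (solve 3 (λ y p s → y :* (p :* s) := p :* (y :* s)) refl (y i) ([]! a) _)
               (*-congˡ (*-distribˡ-sum (y i) (λ c → above y i c * (F′ (above y i) a c * g c))))) ⟩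
      []! a * sum (λ i → sum (λ c → y i * (above y i c * (F′ (above y i) a c * g c))))
        ≈⟨ *-congˡ (∑-comm (λ i c → y i * (above y i c * (F′ (above y i) a c * g c)))) ⟩
      []! a * sum (λ c → sum (λ i → y i * (above y i c * (F′ (above y i) a c * g c))))
        ≈⟨ *-congˡ (sum-scale [ suc a ] _ (λ c → y c * (F′ y (suc a) c * g c)) (λ c → collect c)) ⟩
      []! a * ([ suc a ] * sum (λ c → y c * (F′ y (suc a) c * g c)))
        ≈⟨ *-assoc _ _ _ ⟨
      []! (suc a) * sum (λ c → y c * (F′ y (suc a) c * g c)) ∎
      where
      d = suc (a ℕ.+ (n ℕ.+ k))
      g : Fin N → Carrier
      g c = []! k * Tⁿ n (F x k) c
      next : ∀ i j c → weights (suc a) y (suc j) c * link (j ℕ.<ᵇ suc a) i c ≈ weights a (above y i) j c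
      next i j c with j ℕ.<ᵇ suc a
      ... | true = refl
      ... | false = *-identityʳ (x c)
      collect : ∀ c → sum (λ i → y i * (above y i c * (F′ (above y i) a c * g c))) ≈ [ suc a ] * (y c * (F′ y (suc a) c * g c))
      collect c = begin
        sum (λ i → y i * (above y i c * (F′ (above y i) a c * g c)))
          -- The alphabet with entries y φ(i,·) φ(·,c) can be read as `below (above y i) c` or as
          -- `above (below y c) i`. The second reading allows `sum-F` to carry out the sum over i.
          ≈⟨ sum-scale (y c * g c) _ (λ i → below y c i * F (below y c) a i) (λ i → trans
               (*-congˡ (*-congˡ (*-congʳ (e-cong (λ t → solve 3 (λ y u v → y :* u :* v := y :* v :* u) refl (y t) (φ i t) (φ t c)) a))))
               (solve 5 (λ y p z f g → y :* (z :* p :* (f :* g)) := z :* g :* (y :* p :* f)) refl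
                  (y i) (φ i c) (y c) (F (below y c) a i) (g c))) ⟩
        y c * g c * sum (λ i → below y c i * F (below y c) a i)
          ≈⟨ *-congˡ (sum-F (below y c) a) ⟩
        y c * g c * ([ suc a ] * F′ y (suc a) c)
          ≈⟨ solve 4 (λ y g s f → y :* g :* (s :* f) := s :* (y :* (f :* g))) refl (y c) (g c) [ suc a ] (F′ y (suc a) c) ⟩
        [ suc a ] * (y c * (F′ y (suc a) c * g c)) ∎

    coloringSum-chain : ∀ a n k →
      coloringSum (suc (a ℕ.+ (n ℕ.+ k))) (chain a n) (λ j → x) ≈ []! k * ([]! a * B a n k)
    coloringSum-chain a n k = begin
      coloringSum (suc (a ℕ.+ (n ℕ.+ k))) (chain a n) (λ j → x)
        ≈⟨ coloringSum-cong (suc (a ℕ.+ (n ℕ.+ k))) {E = chain a n} (λ _ _ → ≡.refl) (λ {j} _ → const-weights j) ⟩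
      coloringSum (suc (a ℕ.+ (n ℕ.+ k))) (chain a n) (weights a x)
        ≈⟨ coloringSum-chain-weighted a n k x ⟩
      []! a * sum (λ c → x c * (F′ x a c * ([]! k * Tⁿ n (F x k) c)))
        ≈⟨ *-congˡ (sum-scale ([]! k) _ (λ c → x c * (F′ x a c * Tⁿ n (F x k) c))
             (λ c → solve 4 (λ x f p t → x :* (f :* (p :* t)) := p :* (x :* (f :* t))) refl (x c) (F′ x a c) ([]! k) (Tⁿ n (F x k) c))) ⟩
      []! a * ([]! k * B a n k)
        ≈⟨ solve 3 (λ p r b → p :* (r :* b) := r :* (p :* b)) refl ([]! a) ([]! k) (B a n k) ⟩
      []! k * ([]! a * B a n k) ∎
      where
      const-weights : ∀ j c → x c ≈ weights a x j c
      const-weights j c with j ℕ.<ᵇ suc a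
      ... | true = refl
      ... | false = refl

    B-formula : ∀ a n k → a ℕ.≤ n ℕ.+ k → ∀ {d} → suc (a ℕ.+ (n ℕ.+ k)) ≡ d →
      []! a * B a n k
        ≈ ∑< (suc a) (λ i → q ^ i * []! a * [ d ℕ.∸ 2 ℕ.* i ] * (e x (d ℕ.∸ i) * e x i))
          + ∑< n (λ j → q * [ n ℕ.+ suc k ℕ.∸ j ℕ.∸ 2 ] * ([]! a * B a j 0) * e x (n ℕ.+ suc k ℕ.∸ j ℕ.∸ 1))
    B-formula a n k a≤n+k {d} eq = begin
      []! a * B a n k
        ≈⟨ *-congˡ (trans (B-expand a n k) (+-congʳ (B-closed a (n ℕ.+ k) a≤n+k eq))) ⟩
      []! a * (∑< (suc a) (λ i → q ^ i * [ d ℕ.∸ 2 ℕ.* i ] * (e x (d ℕ.∸ i) * e x i))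
        + ∑< n (λ j → q * [ n ℕ.+ suc k ℕ.∸ j ℕ.∸ 2 ] * B a j 0 * e x (n ℕ.+ suc k ℕ.∸ j ℕ.∸ 1)))
        ≈⟨ distribˡ _ _ _ ⟩
      []! a * ∑< (suc a) (λ i → q ^ i * [ d ℕ.∸ 2 ℕ.* i ] * (e x (d ℕ.∸ i) * e x i))
        + []! a * ∑< n (λ j → q * [ n ℕ.+ suc k ℕ.∸ j ℕ.∸ 2 ] * B a j 0 * e x (n ℕ.+ suc k ℕ.∸ j ℕ.∸ 1))
        ≈⟨ +-cong (*-distribˡ-∑< (suc a) _ _) (*-distribˡ-∑< n _ _) ⟩
      ∑< (suc a) (λ i → []! a * (q ^ i * [ d ℕ.∸ 2 ℕ.* i ] * (e x (d ℕ.∸ i) * e x i)))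
        + ∑< n (λ j → []! a * (q * [ n ℕ.+ suc k ℕ.∸ j ℕ.∸ 2 ] * B a j 0 * e x (n ℕ.+ suc k ℕ.∸ j ℕ.∸ 1)))
        ≈⟨ +-cong
             (∑<-cong (suc a) (λ i _ → solve 4 (λ u p s v → u :* (p :* s :* v) := p :* u :* s :* v) refl _ _ _ _))
             (∑<-cong n (λ j _ → solve 5 (λ u z s b v → u :* (z :* s :* b :* v) := z :* s :* (u :* b) :* v) refl _ _ _ _ _)) ⟩
      ∑< (suc a) (λ i → q ^ i * []! a * [ d ℕ.∸ 2 ℕ.* i ] * (e x (d ℕ.∸ i) * e x i))
        + ∑< n (λ j → q * [ n ℕ.+ suc k ℕ.∸ j ℕ.∸ 2 ] * ([]! a * B a j 0) * e x (n ℕ.+ suc k ℕ.∸ j ℕ.∸ 1)) ∎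

-- The ring of polynomials

module _ {c ℓ} (R : CommutativeRing c ℓ) where
  open CommutativeRing R hiding (zero)
  open import Algebra.Solver.Ring.NaturalCoefficients.Default commutativeSemiring using (solve; _:=_; _:+_; _:*_; con)
  open import Relation.Binary.Reasoning.Setoid setoid

  -- Recursion on the index keeps the truncated difference `n ∸ i` out of the ring laws; it
  -- reappears only in `cauchy-unfold`.
  cauchy : (f g : ℕ → Carrier) → ℕ → Carrier
  cauchy f g zero = f 0 * g 0
  cauchy f g (suc n) = f 0 * g (suc n) + cauchy (f ∘ suc) g n

  one : ℕ → Carrier
  one zero = 1#
  one (suc n) = 0#

  private
    cauchy-cong : ∀ {f f′ g g′ : ℕ → Carrier} → (∀ n → f n ≈ f′ n) → (∀ n → g n ≈ g′ n) → ∀ n → cauchy f g n ≈ cauchy f′ g′ n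
    cauchy-cong hf hg zero = *-cong (hf 0) (hg 0)
    cauchy-cong hf hg (suc n) = +-cong (*-cong (hf 0) (hg (suc n))) (cauchy-cong (hf ∘ suc) hg n)

    cauchy-sucʳ : ∀ f g n → cauchy f g (suc n) ≈ f (suc n) * g 0 + cauchy f (g ∘ suc) n
    cauchy-sucʳ f g zero = +-comm _ _
    cauchy-sucʳ f g (suc n) = trans (+-congˡ (cauchy-sucʳ (f ∘ suc) g n))
      (solve 3 (λ a b c → a :+ (b :+ c) := b :+ (a :+ c)) refl _ _ (cauchy (f ∘ suc) (g ∘ suc) n))

    cauchy-comm : ∀ f g n → cauchy f g n ≈ cauchy g f n
    cauchy-comm f g zero = *-comm _ _
    cauchy-comm f g (suc n) = begin
      f 0 * g (suc n) + cauchy (f ∘ suc) g n  ≈⟨ +-cong (*-comm _ _) (cauchy-comm (f ∘ suc) g n) ⟩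
      g (suc n) * f 0 + cauchy g (f ∘ suc) n  ≈⟨ cauchy-sucʳ g f n ⟨
      cauchy g f (suc n)                      ∎

    cauchy-+ : ∀ f g h n → cauchy (λ i → f i + g i) h n ≈ cauchy f h n + cauchy g h n
    cauchy-+ f g h zero = distribʳ _ _ _
    cauchy-+ f g h (suc n) = trans (+-congˡ (cauchy-+ (f ∘ suc) (g ∘ suc) h n))
      (solve 5 (λ a b c d e → (a :+ b) :* c :+ (d :+ e) := (a :* c :+ d) :+ (b :* c :+ e)) refl
        (f 0) (g 0) (h (suc n)) (cauchy (f ∘ suc) h n) (cauchy (g ∘ suc) h n))

    cauchy-scale : ∀ a f g n → cauchy (λ i → a * f i) g n ≈ a * cauchy f g n
    cauchy-scale a f g zero = *-assoc _ _ _
    cauchy-scale a f g (suc n) = trans (+-cong (*-assoc _ _ _) (cauchy-scale a (f ∘ suc) g n)) (sym (distribˡ _ _ _))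

    cauchy-assoc : ∀ f g h n → cauchy (cauchy f g) h n ≈ cauchy f (cauchy g h) n
    cauchy-assoc f g h zero = *-assoc _ _ _
    cauchy-assoc f g h (suc n) = begin
      f 0 * g 0 * h (suc n) + cauchy (λ i → f 0 * g (suc i) + cauchy (f ∘ suc) g i) h n
        ≈⟨ +-congˡ (trans (cauchy-+ (λ i → f 0 * g (suc i)) (cauchy (f ∘ suc) g) h n)
             (+-cong (cauchy-scale (f 0) (g ∘ suc) h n) (cauchy-assoc (f ∘ suc) g h n))) ⟩
      f 0 * g 0 * h (suc n) + (f 0 * cauchy (g ∘ suc) h n + cauchy (f ∘ suc) (cauchy g h) n)
        ≈⟨ solve 5 (λ a b c d e → a :* b :* c :+ (a :* d :+ e) := a :* (b :* c :+ d) :+ e) refl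
             (f 0) (g 0) (h (suc n)) (cauchy (g ∘ suc) h n) (cauchy (f ∘ suc) (cauchy g h) n) ⟩
      f 0 * (g 0 * h (suc n) + cauchy (g ∘ suc) h n) + cauchy (f ∘ suc) (cauchy g h) n ∎

  cauchy-zeroˡ : ∀ (f g : ℕ → Carrier) → (∀ i → f i ≈ 0#) → ∀ n → cauchy f g n ≈ 0#
  cauchy-zeroˡ f g h zero = trans (*-congʳ (h 0)) (zeroˡ _)
  cauchy-zeroˡ f g h (suc n) = trans (+-cong (trans (*-congʳ (h 0)) (zeroˡ _)) (cauchy-zeroˡ (f ∘ suc) g (h ∘ suc) n)) (+-identityʳ 0#)

  cauchy-constˡ : ∀ (f g : ℕ → Carrier) → (∀ i → f (suc i) ≈ 0#) → ∀ n → cauchy f g n ≈ f 0 * g n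
  cauchy-constˡ f g h zero = refl
  cauchy-constˡ f g h (suc n) = trans (+-congˡ (cauchy-zeroˡ (f ∘ suc) g h n)) (+-identityʳ _)

  private
    cauchy-identityˡ : ∀ f n → cauchy one f n ≈ f n
    cauchy-identityˡ f n = trans (cauchy-constˡ one f (λ i → refl) n) (*-identityˡ (f n))

  powerSeries : CommutativeRing c ℓ
  powerSeries = record
    { Carrier = ℕ → Carrier
    ; _≈_ = λ f g → ∀ n → f n ≈ g n
    ; _+_ = λ f g n → f n + g n
    ; _*_ = cauchy
    ; -_ = λ f n → - f n
    ; 0# = λ n → 0#
    ; 1# = one
    ; isCommutativeRing = record
      { isRing = record
        { +-isAbelianGroup = Pointwise.isAbelianGroup ℕ +-isAbelianGroup
        ; *-cong = cauchy-cong
        ; *-assoc = cauchy-assoc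
        ; *-identity = cauchy-identityˡ , λ f n → trans (cauchy-comm f one n) (cauchy-identityˡ f n)
        ; distrib = (λ f g h n → trans (cauchy-comm f _ n) (trans (cauchy-+ g h f n) (+-cong (cauchy-comm g f n) (cauchy-comm h f n))))
                  , (λ f g h → cauchy-+ g h f)
        }
      ; *-comm = cauchy-comm
      }
    }

  -- The summation operator `S` is abstract, so one proof covers `Σ<` over the integers
  -- (coefficients in q) and `ΣP` over polynomials (coefficients in the first variable). The second
  -- condition starts at two terms because `cauchy` ends in a product without a trailing zero.
  cauchy-unfold : ∀ (S : ℕ → (ℕ → Carrier) → Carrier) →
    (∀ f → S 1 f ≈ f 0) → (∀ n f → S (suc (suc n)) f ≈ f 0 + S (suc n) (f ∘ suc)) →
    ∀ f g n → S (suc n) (λ i → f i * g (n ℕ.∸ i)) ≈ cauchy f g n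
  cauchy-unfold S S1 S2 f g zero = S1 _
  cauchy-unfold S S1 S2 f g (suc n) = trans (S2 n _) (+-congˡ (cauchy-unfold S S1 S2 (f ∘ suc) g n))

-- The product of coefficient functions as an iterated Cauchy product

Σ<-suc : ∀ n f → Σ< (suc n) f ≡ f 0 ℤ.+ Σ< n (f ∘ suc)
Σ<-suc n f = ≡.cong (λ l → f 0 ℤ.+ sumℤ l) (≡.trans (List.map-applyUpTo suc f n) (≡.sym (List.map-upTo (f ∘ suc) n)))

sumℤ-map-cong : ∀ {A : Set} {f g : A → ℤ} → (∀ a → f a ≡ g a) → ∀ xs → sumℤ (map f xs) ≡ sumℤ (map g xs)
sumℤ-map-cong h xs = ≡.cong sumℤ (List.map-cong h xs)

sumℤ-++ : ∀ xs ys → sumℤ (xs List.++ ys) ≡ sumℤ xs ℤ.+ sumℤ ys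
sumℤ-++ [] ys = ≡.sym (ℤ.+-identityˡ _)
sumℤ-++ (x ∷ xs) ys = ≡.trans (≡.cong (λ s → x ℤ.+ s) (sumℤ-++ xs ys)) (≡.sym (ℤ.+-assoc x (sumℤ xs) (sumℤ ys)))

sumℤ-concatMap : ∀ {A B C : Set} (h : C → ℤ) (k : A → B → C) (ys : List B) (xs : List A) →
  sumℤ (map h (concatMap (λ i → map (k i) ys) xs)) ≡ sumℤ (map (λ i → sumℤ (map (h ∘ k i) ys)) xs)
sumℤ-concatMap h k ys [] = ≡.refl
sumℤ-concatMap h k ys (x ∷ xs) = begin
  sumℤ (map h (map (k x) ys List.++ rest))                 ≡⟨ ≡.cong sumℤ (List.map-++ h (map (k x) ys) rest) ⟩
  sumℤ (map h (map (k x) ys) List.++ map h rest)           ≡⟨ sumℤ-++ (map h (map (k x) ys)) (map h rest) ⟩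
  sumℤ (map h (map (k x) ys)) ℤ.+ sumℤ (map h rest)
    ≡⟨ ≡.cong₂ ℤ._+_ (≡.cong sumℤ (≡.sym (List.map-∘ ys))) (sumℤ-concatMap h k ys xs) ⟩
  sumℤ (map (h ∘ k x) ys) ℤ.+ sumℤ (map (λ i → sumℤ (map (h ∘ k i) ys)) xs) ∎
  where
  open ≡.≡-Reasoning
  rest = concatMap (λ i → map (k i) ys) xs

slice : ∀ {N} → Poly (suc N) → ℕ → Poly N
slice f a α = f (a ∷ α)

⊗-∷ : ∀ {N} (f g : Poly (suc N)) a α t →
  (f ⊗ g) (a ∷ α) t ≡ Σ< (suc a) (λ i → (slice f i ⊗ slice g (a ℕ.∸ i)) α t)
⊗-∷ f g a α t = ≡.trans (sumℤ-concatMap _ _ (splits α) (upTo (suc a)))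
  (sumℤ-map-cong (λ i → sumℤ-map-cong (λ { (β , γ) → ≡.refl }) (splits α)) (upTo (suc a)))

Σ<-suc² : ∀ n f → Σ< (suc (suc n)) f ≡ f 0 ℤ.+ Σ< (suc n) (f ∘ suc)
Σ<-suc² n = Σ<-suc (suc n)

⊗-[] : ∀ (f g : Poly 0) t → (f ⊗ g) [] t ≡ cauchy ℤ.+-*-commutativeRing (f []) (g []) t
⊗-[] f g t = ≡.trans (ℤ.+-identityʳ _)
  (cauchy-unfold ℤ.+-*-commutativeRing Σ< (λ h → ℤ.+-identityʳ (h 0)) Σ<-suc² (f []) (g []) t)

infix 4 _≐_
_≐_ : ∀ {N} → Poly N → Poly N → Set
f ≐ g = ∀ α t → f α t ≡ g α t

𝟘 : ∀ {N} → Poly N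
𝟘 α t = + 0

rawPoly : ℕ → RawRing 0ℓ 0ℓ
rawPoly N = record { Carrier = Poly N ; _≈_ = _≐_ ; _+_ = _⊕_ ; _*_ = _⊗_ ; -_ = λ f α t → ℤ.- f α t ; 0# = 𝟘 ; 1# = qpow 0 }

-- The laws are pulled back along injective homomorphisms: `Poly 0` maps to power series in q over
-- the integers, and `Poly (suc N)`, sliced by its first exponent, to power series over `Poly N`.
-- Power series suffice because coefficient functions carry no finiteness condition. The signatures
-- come first since `⊗-slice` at `suc N` already uses the ring at `N`.
isPolyRing : ∀ N → IsCommutativeRing {A = Poly N} _≐_ _⊕_ _⊗_ (λ f α t → ℤ.- f α t) 𝟘 (qpow 0)

polyRing : ℕ → CommutativeRing 0ℓ 0ℓ
polyRing N = record { isCommutativeRing = isPolyRing N }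

⊗-slice : ∀ {N} (f g : Poly (suc N)) a → slice (f ⊗ g) a ≐ cauchy (polyRing N) (slice f) (slice g) a

isPolyRing zero = RingMonomorphism.isCommutativeRing monomorphism (CommutativeRing.isCommutativeRing (powerSeries ℤ.+-*-commutativeRing))
  where
  monomorphism : IsRingMonomorphism (rawPoly 0) (CommutativeRing.rawRing (powerSeries ℤ.+-*-commutativeRing)) (λ f → f [])
  monomorphism = record
    { isRingHomomorphism = record
      { isSemiringHomomorphism = record
        { isNearSemiringHomomorphism = record
          { +-isMonoidHomomorphism = record
            { isMagmaHomomorphism = record
              { isRelHomomorphism = record { cong = λ f≐g → f≐g [] }
              ; homo = λ f g t → ≡.refl
              }
            ; ε-homo = λ t → ≡.refl
            }
          ; *-homo = ⊗-[]
          }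
        ; 1#-homo = λ { zero → ≡.refl ; (suc t) → ≡.refl }
        }
      ; -‿homo = λ f t → ≡.refl
      }
    ; injective = λ { f≈g [] → f≈g }
    }
isPolyRing (suc N) = RingMonomorphism.isCommutativeRing monomorphism (CommutativeRing.isCommutativeRing (powerSeries (polyRing N)))
  where
  monomorphism : IsRingMonomorphism (rawPoly (suc N)) (CommutativeRing.rawRing (powerSeries (polyRing N))) slice
  monomorphism = record
    { isRingHomomorphism = record
      { isSemiringHomomorphism = record
        { isNearSemiringHomomorphism = record
          { +-isMonoidHomomorphism = record
            { isMagmaHomomorphism = record
              { isRelHomomorphism = record { cong = λ f≐g a α → f≐g (a ∷ α) }
              ; homo = λ f g a α t → ≡.refl
              }
            ; ε-homo = λ a α t → ≡.refl
            }
          ; *-homo = ⊗-slice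
          }
        ; 1#-homo = λ { zero α t → ≡.refl ; (suc a) α t → ≡.refl }
        }
      ; -‿homo = λ f a α t → ≡.refl
      }
    ; injective = λ { f≈g (a ∷ α) → f≈g a α }
    }

⊗-slice {N} f g a α t = ≡.trans (⊗-∷ f g a α t)
  (cauchy-unfold (polyRing N) ΣP (λ F α t → ℤ.+-identityʳ (F 0 α t)) (λ n F α t → Σ<-suc² n (λ i → F i α t)) (slice f) (slice g) a α t)

⊗-slice-const : ∀ {N} (f g : Poly (suc N)) → (∀ i → slice f (suc i) ≐ 𝟘) → ∀ a → slice (f ⊗ g) a ≐ slice f 0 ⊗ slice g a
⊗-slice-const {N} f g h a α t = ≡.trans (⊗-slice f g a α t) (cauchy-constˡ (polyRing N) (slice f) (slice g) h a α t)

qpow-slice : ∀ {N} k i → slice {N} (qpow k) (suc i) ≐ 𝟘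
qpow-slice k i α t = ≡.refl

q⊗-zero : ∀ {N} (f : Poly N) α → (qpow 1 ⊗ f) α 0 ≡ + 0
q⊗-zero f [] = ≡.trans (⊗-[] (qpow 1) f 0) (ℤ.*-zeroˡ (f [] 0))
q⊗-zero f (a ∷ α) = ≡.trans (⊗-slice-const (qpow 1) f (qpow-slice 1) a α 0) (q⊗-zero (slice f a) α)

q⊗-suc : ∀ {N} (f : Poly N) α t → (qpow 1 ⊗ f) α (suc t) ≡ f α t
q⊗-suc f [] t = begin
  (qpow 1 ⊗ f) [] (suc t)                          ≡⟨ ⊗-[] (qpow 1) f (suc t) ⟩
  + 0 ℤ.* f [] (suc t) ℤ.+ cauchy ℤ.+-*-commutativeRing (qpow {0} 1 [] ∘ suc) (f []) t
    ≡⟨ ≡.cong₂ ℤ._+_ (ℤ.*-zeroˡ (f [] (suc t))) (cauchy-constˡ ℤ.+-*-commutativeRing (qpow {0} 1 [] ∘ suc) (f []) (λ i → ≡.refl) t) ⟩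
  + 0 ℤ.+ + 1 ℤ.* f [] t                           ≡⟨ ≡.trans (ℤ.+-identityˡ _) (ℤ.*-identityˡ (f [] t)) ⟩
  f [] t                                           ∎
  where open ≡.≡-Reasoning
q⊗-suc f (a ∷ α) t = ≡.trans (⊗-slice-const (qpow 1) f (qpow-slice 1) a α (suc t)) (q⊗-suc (slice f a) α t)

q⊗-≐ : ∀ {N} (f g : Poly N) → (∀ α → g α 0 ≡ + 0) → (∀ α t → g α (suc t) ≡ f α t) → qpow 1 ⊗ f ≐ g
q⊗-≐ f g h₀ h₁ α zero = ≡.trans (q⊗-zero f α) (≡.sym (h₀ α))
q⊗-≐ f g h₀ h₁ α (suc t) = ≡.trans (q⊗-suc f α t) (≡.sym (h₁ α t))

-- Variables and elementary symmetric polynomials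

ι : ∀ {N} → Poly N → Poly (suc N)
ι f (zero ∷ α) = f α
ι f (suc a ∷ α) t = + 0

var : ∀ {N} → Fin N → Poly N
var zero (zero ∷ α) t = + 0
var zero (suc zero ∷ α) t = qpow 0 α t
var zero (suc (suc a) ∷ α) t = + 0
var (suc c) = ι (var c)

ι⊗ : ∀ {N} (f : Poly N) g a → slice (ι f ⊗ g) a ≐ f ⊗ slice g a
ι⊗ f g = ⊗-slice-const (ι f) g (λ i α t → ≡.refl)

var₀⊗-zero : ∀ {N} (g : Poly (suc N)) → slice (var zero ⊗ g) 0 ≐ 𝟘
var₀⊗-zero {N} g α t = ≡.trans (⊗-slice (var zero) g 0 α t) (CommutativeRing.zeroˡ (polyRing N) (slice g 0) α t)

var₀⊗-suc : ∀ {N} (g : Poly (suc N)) a → slice (var zero ⊗ g) (suc a) ≐ slice g a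
var₀⊗-suc {N} g a = trans {i = slice (var zero ⊗ g) (suc a)} (⊗-slice (var zero) g (suc a))
  (trans {i = 𝟘 ⊗ slice g (suc a) ⊕ c} {j = 𝟘 ⊕ slice g a} {k = slice g a}
    (+-cong {x = 𝟘 ⊗ slice g (suc a)} {y = 𝟘} {u = c} {v = slice g a} (zeroˡ (slice g (suc a)))
      (trans {i = c} {j = qpow 0 ⊗ slice g a} {k = slice g a} (cauchy-constˡ (polyRing N) (slice (var zero) ∘ suc) (slice g) (λ i α t → ≡.refl) a) (*-identityˡ (slice g a))))
    (+-identityˡ (slice g a)))
  where
  open CommutativeRing (polyRing N) using (trans; +-cong; zeroˡ; +-identityˡ; *-identityˡ)
  c = cauchy (polyRing N) (slice (var zero) ∘ suc) (slice g) a

module Poly-q (N : ℕ) = Interaction (polyRing N) (qpow 1)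

module _ {N : ℕ} where
  open CommutativeRing (polyRing N) hiding (zero)
  open import Algebra.Properties.Semiring.Exp semiring using (_^_)
  open Poly-q N
  open import Relation.Binary.Reasoning.Setoid setoid

  qpow-suc : ∀ k → qpow 1 ⊗ qpow k ≐ qpow {N} (suc k)
  qpow-suc k = q⊗-≐ (qpow k) (qpow (suc k)) (λ α → ≡.cong (λ b → if b then + 1 else + 0) (∧-zeroʳ (isZeroᵇ α))) (λ α t → ≡.refl)

  qpow-^ : ∀ k → qpow {N} k ≈ qpow 1 ^ k
  qpow-^ zero = refl
  qpow-^ (suc k) = trans (sym (qpow-suc k)) (*-congˡ {x = qpow 1} (qpow-^ k))

  ΣP-∑< : ∀ k (F : ℕ → Poly N) → ΣP k F ≈ ∑< k F
  ΣP-∑< zero F α t = ≡.refl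
  ΣP-∑< (suc k) F α t = ≡.trans snoc (≡.cong (λ z → z ℤ.+ F k α t) (ΣP-∑< k F α t))
    where
    snoc : Σ< (suc k) (λ i → F i α t) ≡ Σ< k (λ i → F i α t) ℤ.+ F k α t
    snoc = ≡.trans (≡.cong (sumℤ ∘ map (λ i → F i α t)) (≡.sym (List.upTo-∷ʳ k)))
      (≡.trans (≡.cong sumℤ (List.map-++ _ (upTo k) (k ∷ [])))
        (≡.trans (sumℤ-++ (map _ (upTo k)) _) (≡.cong (λ z → Σ< k (λ i → F i α t) ℤ.+ z) (ℤ.+-identityʳ _))))

  ∑<-pow : ∀ k → ∑< k (λ i → qpow 1 ^ i) ≈ [ k ]
  ∑<-pow zero = refl
  ∑<-pow (suc k) = trans (+-congʳ {x = qpow 1 ^ k} (∑<-pow k)) (sym ([]-suc k))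

  qint-[] : ∀ k → qint {N} k ≈ [ k ]
  qint-[] k = begin
    ΣP k qpow                 ≈⟨ ΣP-∑< k qpow ⟩
    ∑< k qpow                 ≈⟨ ∑<-cong k (λ i _ → qpow-^ i) ⟩
    ∑< k (λ i → qpow 1 ^ i)   ≈⟨ ∑<-pow k ⟩
    [ k ]                     ∎

  qfact-[]! : ∀ k → qfact {N} k ≈ []! k
  qfact-[]! zero = refl
  qfact-[]! (suc k) = *-cong {x = qfact k} {y = []! k} {u = qint (suc k)} (qfact-[]! k) (qint-[] (suc k))

-- The alphabet size `M` is separate from the number of variables `N`: the recursion of `e` drops an
-- alphabet entry while the ambient ring stays the same.
ι-e : ∀ {N M} (y : Fin M → Poly N) k → Poly-q.e (suc N) (ι ∘ y) k ≐ ι (Poly-q.e N y k)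
ι-e y zero (zero ∷ α) t = ≡.refl
ι-e y zero (suc a ∷ α) t = ≡.refl
ι-e {M = zero} y (suc k) (zero ∷ α) t = ≡.refl
ι-e {M = zero} y (suc k) (suc a ∷ α) t = ≡.refl
ι-e {N} {M = suc M} y (suc k) = λ
  { (zero ∷ α) t → ≡.cong₂ ℤ._+_ (ι-e (y ∘ suc) (suc k) (0 ∷ α) t) (product 0 α t)
  ; (suc a ∷ α) t → ≡.trans (≡.cong₂ ℤ._+_ (ι-e (y ∘ suc) (suc k) (suc a ∷ α) t) (product (suc a) α t))
      (≡.trans (ℤ.+-identityˡ _) (CommutativeRing.zeroʳ (polyRing N) (y zero) α t))
  }
  where
  product : ∀ a α t → (ι (y zero) ⊗ Poly-q.e (suc N) (ι ∘ y ∘ suc) k) (a ∷ α) t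
    ≡ (y zero ⊗ slice (ι (Poly-q.e N (y ∘ suc) k)) a) α t
  product a α t = ≡.trans (ι⊗ (y zero) (Poly-q.e (suc N) (ι ∘ y ∘ suc) k) a α t)
    (CommutativeRing.*-congˡ (polyRing N) {x = y zero} {x = slice (Poly-q.e (suc N) (ι ∘ y ∘ suc) k) a}
      (λ β s → ι-e (y ∘ suc) k (a ∷ β) s) α t)

-- Slicing by the exponent of the first variable turns the indicator defining `elem` into the
-- recursion of `e`: exponent 0 keeps `k`, exponent 1 lowers it by one, and larger exponents give
-- zero.
elem-e : ∀ {N} k → elem {N} k ≐ Poly-q.e N var k
elem-e {N} zero α t = elem₀ α t
  where
  elem₀ : ∀ {N} → elem {N} 0 ≐ qpow 0
  elem₀ [] t = ≡.refl
  elem₀ (zero ∷ α) t = elem₀ α t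
  elem₀ (suc zero ∷ α) t = ≡.cong (λ b → if b then + 1 else + 0) (∧-zeroʳ (all≤1ᵇ α))
  elem₀ (suc (suc a) ∷ α) t = ≡.refl
elem-e {zero} (suc k) [] t = ≡.refl
elem-e {suc N} (suc k) (zero ∷ α) t = ≡.trans (elem-e (suc k) α t) (≡.sym (≡.trans
  (≡.cong₂ ℤ._+_ (ι-e var (suc k) (0 ∷ α) t) (var₀⊗-zero (Poly-q.e (suc N) (ι ∘ var) k) α t)) (ℤ.+-identityʳ _)))
elem-e {suc N} (suc k) (suc a ∷ α) t = ≡.trans (top a) (≡.sym (≡.trans
  (≡.cong₂ ℤ._+_ (ι-e var (suc k) (suc a ∷ α) t) (var₀⊗-suc (Poly-q.e (suc N) (ι ∘ var) k) a α t)) (ℤ.+-identityˡ _)))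
  where
  top : ∀ a → elem (suc k) (suc a ∷ α) t ≡ Poly-q.e (suc N) (ι ∘ var) k (a ∷ α) t
  top zero = ≡.trans (elem-e k α t) (≡.sym (ι-e var k (0 ∷ α) t))
  top (suc a) = ≡.sym (ι-e var k (suc a ∷ α) t)

-- Colorings as products of edge weights

-- An arbitrary monoid is taken because the same lemmas serve for sums and products in the ring and
-- for counting edges in ℕ.
module ListFold {c ℓ} (M : Monoid c ℓ) where
  open Monoid M
  open import Algebra.Definitions.RawMonoid rawMonoid using (sum)

  fold : ∀ {A : Set} → (A → Carrier) → List A → Carrier
  fold f [] = ε
  fold f (x ∷ xs) = f x ∙ fold f xs

  fold-cong : ∀ {A : Set} {f g : A → Carrier} → (∀ a → f a ≈ g a) → ∀ xs → fold f xs ≈ fold g xs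
  fold-cong h [] = refl
  fold-cong h (x ∷ xs) = ∙-cong (h x) (fold-cong h xs)

  fold-++ : ∀ {A : Set} (f : A → Carrier) xs ys → fold f (xs List.++ ys) ≈ fold f xs ∙ fold f ys
  fold-++ f [] ys = sym (identityˡ _)
  fold-++ f (x ∷ xs) ys = trans (∙-congˡ (fold-++ f xs ys)) (sym (assoc _ _ _))

  fold-map : ∀ {A B : Set} (f : B → Carrier) (g : A → B) xs → fold f (map g xs) ≈ fold (f ∘ g) xs
  fold-map f g [] = refl
  fold-map f g (x ∷ xs) = ∙-congˡ (fold-map f g xs)

  fold-concatMap : ∀ {A B C : Set} (f : C → Carrier) (k : A → B → C) ys xs →
    fold f (concatMap (λ i → map (k i) ys) xs) ≈ fold (λ i → fold (f ∘ k i) ys) xs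
  fold-concatMap f k ys [] = refl
  fold-concatMap f k ys (x ∷ xs) = trans (fold-++ f (map (k x) ys) _) (∙-cong (fold-map f (k x) ys) (fold-concatMap f k ys xs))

  fold-tabulate : ∀ {A : Set} {n} (f : A → Carrier) (g : Fin n → A) → fold f (List.tabulate g) ≈ sum (f ∘ g)
  fold-tabulate {n = zero} f g = refl
  fold-tabulate {n = suc n} f g = ∙-congˡ (fold-tabulate f (g ∘ suc))

  fold-pairsOf : ∀ {d} (f : Fin d × Fin d → Carrier) → fold f (pairsOf d) ≈ sum (λ i → sum (λ j → f (i , j)))
  fold-pairsOf {d} f = trans (fold-concatMap f _,_ (allFin d) (allFin d))
    (trans (fold-cong (λ i → fold-tabulate (λ j → f (i , j)) id) (allFin d)) (fold-tabulate {n = d} _ id))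

module Weights {c ℓ} (R : CommutativeRing c ℓ) (q : CommutativeRing.Carrier R) where
  open CommutativeRing R hiding (zero)
  open Interaction R q using (φ; link; coloringSum)
  open import Algebra.Properties.Semiring.Sum semiring
  open import Algebra.Properties.Semiring.Exp semiring using (_^_)
  import Algebra.Properties.CommutativeMonoid.Sum *-commutativeMonoid as Π
  open import Relation.Binary.Reasoning.Setoid setoid
  open import Algebra.Solver.Ring.NaturalCoefficients.Default commutativeSemiring using (solve; _:=_; _:+_; _:*_; con)
  module ΣL = ListFold +-monoid
  module ΠL = ListFold *-monoid

  mass : ∀ {N d} → (ℕ → Fin N → Carrier) → Vec (Fin N) d → Carrier
  mass Y κ = Π.sum (λ i → Y (toℕ i) (lookup κ i))

  pairWeight : ∀ {N d} → (ℕ → ℕ → Bool) → Vec (Fin N) d → Fin d × Fin d → Carrier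
  pairWeight E κ (i , j) = link ((toℕ i <ᵇ toℕ j) ∧ E (toℕ i) (toℕ j)) (lookup κ i) (lookup κ j)

  interaction : ∀ {N d} → (ℕ → ℕ → Bool) → Vec (Fin N) d → Carrier
  interaction {d = d} E κ = ΠL.fold (pairWeight E κ) (pairsOf d)

  interaction-∷ : ∀ {N d} E c (κ : Vec (Fin N) d) →
    interaction E (c ∷ κ) ≈ mass (λ j → link (E 0 (suc j)) c) κ * interaction (λ i j → E (suc i) (suc j)) κ
  interaction-∷ E c κ = begin
    interaction E (c ∷ κ)
      ≈⟨ ΠL.fold-pairsOf (pairWeight E (c ∷ κ)) ⟩
    -- The factors `1#` belong to the pairs (0,0) and (i,0), which fail the order test.
    (1# * mass (λ j → link (E 0 (suc j)) c) κ) * Π.sum (λ i → 1# * Π.sum (λ j → pairWeight E′ κ (i , j)))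
      ≈⟨ *-cong (*-identityˡ _) (Π.sum-cong-≋ (λ i → *-identityˡ (Π.sum (λ j → pairWeight E′ κ (i , j))))) ⟩
    mass (λ j → link (E 0 (suc j)) c) κ * Π.sum (λ i → Π.sum (λ j → pairWeight E′ κ (i , j)))
      ≈⟨ *-congˡ (ΠL.fold-pairsOf (pairWeight E′ κ)) ⟨
    mass (λ j → link (E 0 (suc j)) c) κ * interaction E′ κ ∎
    where
    E′ : ℕ → ℕ → Bool
    E′ i j = E (suc i) (suc j)

  fold-scale : ∀ {A : Set} a (f : A → Carrier) xs → ΣL.fold (λ x → a * f x) xs ≈ a * ΣL.fold f xs
  fold-scale a f [] = sym (zeroʳ a)
  fold-scale a f (x ∷ xs) = trans (+-congˡ (fold-scale a f xs)) (sym (distribˡ a _ _))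

  -- The recursive sum stores the edges at vertex 0 in the weights of later vertices. Splitting the
  -- mass of these weights gives them back as the first row of `interaction`.
  coloringSum-colorings : ∀ {N} d E (Y : ℕ → Fin N → Carrier) →
    coloringSum d E Y ≈ ΣL.fold (λ κ → mass Y κ * interaction E κ) (colorings N d)
  coloringSum-colorings zero E Y = solve 0 (con 1 := con 1 :* con 1 :+ con 0) refl
  coloringSum-colorings {N} (suc d) E Y = begin
    sum (λ c → Y 0 c * coloringSum d E′ (Y′ c))
      ≈⟨ sum-cong-≋ (λ c → step c) ⟩
    sum (λ c → ΣL.fold (λ κ → mass Y (c ∷ κ) * interaction E (c ∷ κ)) (colorings N d))
      ≈⟨ ΣL.fold-tabulate (λ c → ΣL.fold (λ κ → mass Y (c ∷ κ) * interaction E (c ∷ κ)) (colorings N d)) id ⟨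
    ΣL.fold (λ c → ΣL.fold (λ κ → mass Y (c ∷ κ) * interaction E (c ∷ κ)) (colorings N d)) (allFin N)
      ≈⟨ ΣL.fold-concatMap (λ κ → mass Y κ * interaction E κ) _∷_ (colorings N d) (allFin N) ⟨
    ΣL.fold (λ κ → mass Y κ * interaction E κ) (colorings N (suc d)) ∎
    where
    E′ : ℕ → ℕ → Bool
    E′ i j = E (suc i) (suc j)
    Y′ : Fin N → ℕ → Fin N → Carrier
    Y′ c j c′ = Y (suc j) c′ * link (E 0 (suc j)) c c′
    step : ∀ c → Y 0 c * coloringSum d E′ (Y′ c)
      ≈ ΣL.fold (λ κ → mass Y (c ∷ κ) * interaction E (c ∷ κ)) (colorings N d)
    step c = begin
      Y 0 c * coloringSum d E′ (Y′ c)
        ≈⟨ *-congˡ (coloringSum-colorings d E′ (Y′ c)) ⟩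
      Y 0 c * ΣL.fold (λ κ → mass (Y′ c) κ * interaction E′ κ) (colorings N d)
        ≈⟨ fold-scale (Y 0 c) (λ κ → mass (Y′ c) κ * interaction E′ κ) (colorings N d) ⟨
      ΣL.fold (λ κ → Y 0 c * (mass (Y′ c) κ * interaction E′ κ)) (colorings N d)
        ≈⟨ ΣL.fold-cong (λ κ → trans
             (*-congˡ (*-congʳ (Π.∑-distrib-+ (λ i → Y (suc (toℕ i)) (lookup κ i)) (λ i → link (E 0 (suc (toℕ i))) c (lookup κ i)))))
             (trans (solve 4 (λ y m l i → y :* (m :* l :* i) := y :* m :* (l :* i)) refl (Y 0 c) (mass (Y ∘ suc) κ)
                       (mass (λ j → link (E 0 (suc j)) c) κ) (interaction E′ κ))
                    (*-congˡ (sym (interaction-∷ E c κ))))) (colorings N d) ⟩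
      ΣL.fold (λ κ → mass Y (c ∷ κ) * interaction E (c ∷ κ)) (colorings N d) ∎

  φ-compare : ∀ {N} (c c′ : Fin N) →
    φ c c′ ≡ (if toℕ c ≡ᵇ toℕ c′ then 0# else (if toℕ c <ᵇ toℕ c′ then q else 1#))
  φ-compare zero zero = ≡.refl
  φ-compare zero (suc c′) = ≡.refl
  φ-compare (suc c) zero = ≡.refl
  φ-compare (suc c) (suc c′) = φ-compare c c′

  link-compare : ∀ {N} b (c c′ : Fin N) →
    link b c c′ ≡ (if b ∧ (toℕ c ≡ᵇ toℕ c′) then 0# else (if b ∧ (toℕ c <ᵇ toℕ c′) then q else 1#))
  link-compare false c c′ = ≡.refl
  link-compare true c c′ = φ-compare c c′

  -- One monochromatic edge annihilates the product; otherwise each ascent contributes `q`. Phrasing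
  -- both through `countᵇ` makes the result match `properᵇ` and `asc`.
  fold-indicator : ∀ {A : Set} (w : A → Carrier) (zero? q? : A → Bool) →
    (∀ a → w a ≈ (if zero? a then 0# else (if q? a then q else 1#))) →
    ∀ xs → ΠL.fold w xs ≈ (if countᵇ zero? xs ≡ᵇ 0 then q ^ countᵇ q? xs else 0#)
  fold-indicator w zero? q? h [] = refl
  fold-indicator w zero? q? h (x ∷ xs) with zero? x | q? x | h x
  ... | true | _ | w≈0 = trans (*-congʳ w≈0) (zeroˡ _)
  ... | false | true | w≈q = trans (*-cong w≈q (fold-indicator w zero? q? h xs)) (if-scale (countᵇ zero? xs ≡ᵇ 0))
    where
    if-scale : ∀ b → q * (if b then q ^ countᵇ q? xs else 0#) ≈ (if b then q ^ suc (countᵇ q? xs) else 0#)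
    if-scale true = refl
    if-scale false = zeroʳ q
  ... | false | false | w≈1 = trans (*-cong w≈1 (fold-indicator w zero? q? h xs)) (*-identityˡ _)

edge₀ : Graph → ℕ → ℕ → Bool
edge₀ G i j = edge G (suc i) (suc j)

countᵇ-tabulate : ∀ {A : Set} {n} (p : A → Bool) (g : Fin n → A) → countᵇ p (List.tabulate g) ≡ countᵇ (p ∘ g) (allFin n)
countᵇ-tabulate {n = zero} p g = ≡.refl
countᵇ-tabulate {n = suc n} p g with p (g zero)
... | true = ≡.cong suc (≡.trans (countᵇ-tabulate p (g ∘ suc)) (≡.sym (countᵇ-tabulate (p ∘ g) suc)))
... | false = ≡.trans (countᵇ-tabulate p (g ∘ suc)) (≡.sym (countᵇ-tabulate (p ∘ g) suc))

bump : ∀ {N} → Fin N → Mono N → Mono N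
bump zero (a ∷ α) = suc a ∷ α
bump (suc c) (a ∷ α) = a ∷ bump c α

bump-tabulate : ∀ {N} (c : Fin N) (f : Fin N → ℕ) →
  tabulate (λ c′ → if toℕ c ≡ᵇ toℕ c′ then suc (f c′) else f c′) ≡ bump c (tabulate f)
bump-tabulate zero f = ≡.refl
bump-tabulate (suc c) f = ≡.cong (f zero ∷_) (bump-tabulate c (f ∘ suc))

content-∷ : ∀ {N d} c (κ : Vec (Fin N) d) → content (c ∷ κ) ≡ bump c (content κ)
content-∷ {N} {d} c κ = ≡.trans
  (Vec.tabulate-cong (λ c′ → ≡.cong (λ k → if toℕ c ≡ᵇ toℕ c′ then suc k else k)
    (countᵇ-tabulate {n = d} (λ i → toℕ (lookup (c ∷ κ) i) ≡ᵇ toℕ c′) suc)))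
  (bump-tabulate c (λ c′ → countᵇ (λ i → toℕ (lookup κ i) ≡ᵇ toℕ c′) (allFin d)))

mono : ∀ {N} → Mono N → ℕ → Poly N
mono α s β t = if monoEqᵇ α β ∧ (s ≡ᵇ t) then + 1 else + 0

var⊗mono : ∀ {N} (c : Fin N) α s → var c ⊗ mono α s ≐ mono (bump c α) s
var⊗mono zero (a ∷ α) s (zero ∷ β) t = var₀⊗-zero (mono (a ∷ α) s) β t
var⊗mono zero (a ∷ α) s (suc b ∷ β) t = var₀⊗-suc (mono (a ∷ α) s) b β t
var⊗mono {suc N} (suc c) (a ∷ α) s (b ∷ β) t = ≡.trans (ι⊗ (var c) (mono (a ∷ α) s) b β t) split
  where
  split : (var c ⊗ slice (mono (a ∷ α) s) b) β t ≡ mono (bump (suc c) (a ∷ α)) s (b ∷ β) t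
  split with a ≡ᵇ b
  ... | true = var⊗mono c α s β t
  ... | false = CommutativeRing.zeroʳ (polyRing N) (var c) β t

module _ {N : ℕ} where
  open CommutativeRing (polyRing N) hiding (zero)
  open import Algebra.Properties.Semiring.Exp semiring using (_^_)
  open Poly-q N
  open Weights (polyRing N) (qpow 1)
  open import Relation.Binary.Reasoning.Setoid setoid

  mono-zero : ∀ {N} → mono {N} (Vec.replicate N 0) 0 ≐ qpow 0
  mono-zero [] zero = ≡.refl
  mono-zero [] (suc t) = ≡.refl
  mono-zero (zero ∷ α) t = mono-zero α t
  mono-zero (suc a ∷ α) t = ≡.refl

  content-[] : ∀ {N} → content {N} [] ≡ Vec.replicate N 0
  content-[] {zero} = ≡.refl
  content-[] {suc N} = ≡.cong (0 ∷_) content-[]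

  mass-mono : ∀ {d} (κ : Vec (Fin N) d) → mass (λ _ → var) κ ≈ mono (content κ) 0
  mass-mono [] = sym (trans (λ β t → ≡.cong (λ α → mono α 0 β t) (content-[] {N})) mono-zero)
  mass-mono (c ∷ κ) = begin
    var c ⊗ mass (λ _ → var) κ    ≈⟨ *-congˡ {x = var c} (mass-mono κ) ⟩
    var c ⊗ mono (content κ) 0    ≈⟨ var⊗mono c (content κ) 0 ⟩
    mono (bump c (content κ)) 0   ≡⟨ ≡.cong (λ α → mono α 0) (content-∷ c κ) ⟨
    mono (content (c ∷ κ)) 0      ∎

  mono⊗q^ : ∀ α k → mono α 0 ⊗ qpow 1 ^ k ≈ mono α k
  mono⊗q^ α zero = *-identityʳ (mono α 0)
  mono⊗q^ α (suc k) = begin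
    mono α 0 ⊗ (qpow 1 ⊗ qpow 1 ^ k)  ≈⟨ x∙yz≈y∙xz (mono α 0) (qpow 1) (qpow 1 ^ k) ⟩
    qpow 1 ⊗ (mono α 0 ⊗ qpow 1 ^ k)  ≈⟨ *-congˡ {x = qpow 1} (mono⊗q^ α k) ⟩
    qpow 1 ⊗ mono α k                 ≈⟨ q⊗-≐ (mono α k) (mono α (suc k)) (λ β → ≡.cong (λ b → if b then + 1 else + 0) (∧-zeroʳ (monoEqᵇ α β))) (λ β t → ≡.refl) ⟩
    mono α (suc k)                    ∎
    where open import Algebra.Properties.CommutativeSemigroup *-commutativeSemigroup using (x∙yz≈y∙xz)

  X-coloringSum : ∀ G → X G ≈ coloringSum (size G) (edge₀ G) (λ _ → var)
  X-coloringSum G = begin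
    X G
      ≈⟨ X-fold (colorings N (size G)) ⟩
    ΣL.fold (λ κ → if properᵇ G κ then mono (content κ) (asc G κ) else 𝟘) (colorings N (size G))
      ≈⟨ ΣL.fold-cong (λ κ → sym (weight κ)) (colorings N (size G)) ⟩
    ΣL.fold (λ κ → mass (λ _ → var) κ ⊗ interaction (edge₀ G) κ) (colorings N (size G))
      ≈⟨ coloringSum-colorings (size G) (edge₀ G) (λ _ → var) ⟨
    coloringSum (size G) (edge₀ G) (λ _ → var) ∎
    where
    X-fold : ∀ κs → (λ α t → + countᵇ (λ κ → properᵇ G κ ∧ monoEqᵇ (content κ) α ∧ (asc G κ ≡ᵇ t)) κs)
      ≈ ΣL.fold (λ κ → if properᵇ G κ then mono (content κ) (asc G κ) else 𝟘) κs
    X-fold [] α t = ≡.refl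
    X-fold (κ ∷ κs) α t with properᵇ G κ
    ... | false = ≡.trans (X-fold κs α t) (≡.sym (ℤ.+-identityˡ _))
    ... | true with monoEqᵇ (content κ) α ∧ (asc G κ ≡ᵇ t)
    ... | true = ≡.cong (λ z → + 1 ℤ.+ z) (X-fold κs α t)
    ... | false = ≡.trans (X-fold κs α t) (≡.sym (ℤ.+-identityˡ _))

    weight : ∀ κ → mass (λ _ → var) κ ⊗ interaction (edge₀ G) κ ≈ (if properᵇ G κ then mono (content κ) (asc G κ) else 𝟘)
    weight κ = trans
      (*-cong {x = mass (λ _ → var) κ} {y = mono (content κ) 0} {u = interaction (edge₀ G) κ} (mass-mono κ)
        (fold-indicator (pairWeight (edge₀ G) κ)
          (λ p → isEdgeᵇ G p ∧ (toℕ (lookup κ (proj₁ p)) ≡ᵇ toℕ (lookup κ (proj₂ p))))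
          (λ p → isEdgeᵇ G p ∧ (toℕ (lookup κ (proj₁ p)) <ᵇ toℕ (lookup κ (proj₂ p))))
          (λ p → reflexive (link-compare (isEdgeᵇ G p) (lookup κ (proj₁ p)) (lookup κ (proj₂ p)))) (pairsOf (size G))))
      (distribute (properᵇ G κ))
      where
      distribute : ∀ b → mono (content κ) 0 ⊗ (if b then qpow 1 ^ asc G κ else 𝟘) ≈ (if b then mono (content κ) (asc G κ) else 𝟘)
      distribute true = mono⊗q^ (content κ) (asc G κ)
      distribute false = zeroʳ (mono (content κ) 0)

-- Sums of q ^ a [ b ] e_λ with a common centre

-- The binomial coefficient of `d` over 2: the number of edges of a clique on `d` vertices and at
-- the same time the degree in q of `[]! d`. This coincidence puts the centre at half the number of
-- edges.
triangle : ℕ → ℕ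
triangle zero = 0
triangle (suc d) = d ℕ.+ triangle d

module BlockSums {c ℓ} (R : CommutativeRing c ℓ) (q : CommutativeRing.Carrier R) where
  open CommutativeRing R hiding (zero)
  open Interaction R q
  open import Algebra.Properties.Semiring.Exp semiring using (_^_)
  open import Algebra.Solver.Ring.NaturalCoefficients.Default commutativeSemiring using (solve; _:=_; _:+_; _:*_; con)
  open import Relation.Binary.Reasoning.Setoid setoid

  module Blocks-of {N : ℕ} (x : Vector Carrier N) (E : List ℕ → Carrier)
    (E-[] : E [] ≈ 1#) (E-∷ : ∀ k ks → E (k ∷ ks) ≈ e x k * E ks) where

    -- The coefficients of q ^ a * [ b ] are 1 on the interval a,…,a+b-1, which is centred at d/2.
    data Blocks (d : ℕ) : Carrier → Set (c ⊔ ℓ) where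
      block : ∀ a b ks → a ℕ.+ a ℕ.+ b ≡ suc d → Blocks d (q ^ a * ([ b ] * E ks))
      none : Blocks d 0#
      _⊞_ : ∀ {f g} → Blocks d f → Blocks d g → Blocks d (f + g)
      resp : ∀ {f g} → f ≈ g → Blocks d f → Blocks d g

    recentre : ∀ {d d′ f} → d ≡ d′ → Blocks d f → Blocks d′ f
    recentre ≡.refl p = p

    *-blocks : ∀ {d d′} h → (∀ a b ks → a ℕ.+ a ℕ.+ b ≡ suc d → Blocks d′ (h * (q ^ a * ([ b ] * E ks)))) →
      ∀ {f} → Blocks d f → Blocks d′ (h * f)
    *-blocks h on-block (block a b ks eq) = on-block a b ks eq
    *-blocks h on-block none = resp (sym (zeroʳ h)) none
    *-blocks h on-block (p ⊞ r) = resp (sym (distribˡ h _ _)) (*-blocks h on-block p ⊞ *-blocks h on-block r)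
    *-blocks h on-block (resp f≈g p) = resp (*-congˡ f≈g) (*-blocks h on-block p)

    q*-blocks : ∀ {d f} → Blocks d f → Blocks (suc (suc d)) (q * f)
    q*-blocks = *-blocks q (λ a b ks eq → resp (*-assoc _ _ _)
      (block (suc a) b ks (≡.cong suc (≡.trans (≡.cong (ℕ._+ b) (ℕ.+-suc a a)) (≡.cong suc eq)))))

    e*-blocks : ∀ {d f} k → Blocks d f → Blocks d (e x k * f)
    e*-blocks k = *-blocks (e x k) (λ a b ks eq → resp
      (trans (*-congˡ (*-congˡ (E-∷ k ks))) (solve 4 (λ p s e E → p :* (s :* (e :* E)) := e :* (p :* (s :* E))) refl (q ^ a) [ b ] (e x k) (E ks)))
      (block a b (k ∷ ks) eq))

    -- By `[]-*` the product sheds its longest interval, and the rest is a shorter product starting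
    -- one exponent higher. Both have the same centre, so the recursion stays inside one `Blocks`
    -- family until a factor is exhausted.
    []*-block : ∀ k {d} a b ks → a ℕ.+ a ℕ.+ b ≡ suc d → Blocks (d ℕ.+ k) ([ suc k ] * (q ^ a * ([ b ] * E ks)))
    []*-block k a zero ks eq = resp (solve 3 (λ s p E → con 0 := s :* (p :* (con 0 :* E))) refl [ suc k ] (q ^ a) (E ks)) none
    []*-block zero {d} a b ks eq = resp (solve 2 (λ z y → y := (con 1 :+ z :* con 0) :* y) refl q _)
      (block a b ks (≡.trans eq (≡.cong suc (≡.sym (ℕ.+-identityʳ d)))))
    []*-block (suc k) {d} a (suc b) ks eq = resp (begin
      q ^ a * ([ suc (b ℕ.+ suc k) ] * E ks) + [ suc k ] * (q ^ suc a * ([ b ] * E ks))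
        ≈⟨ solve 6 (λ z p s E t u → p :* (s :* E) :+ t :* (z :* p :* (u :* E)) := (s :+ z :* (u :* t)) :* (p :* E)) refl
             q (q ^ a) [ suc (b ℕ.+ suc k) ] (E ks) [ suc k ] [ b ] ⟩
      ([ suc (b ℕ.+ suc k) ] + q * ([ b ] * [ suc k ])) * (q ^ a * E ks)
        ≈⟨ *-congʳ ([]-* b (suc k)) ⟨
      [ suc b ] * [ suc (suc k) ] * (q ^ a * E ks)
        ≈⟨ solve 4 (λ s t p E → s :* t :* (p :* E) := t :* (p :* (s :* E))) refl [ suc b ] [ suc (suc k) ] (q ^ a) (E ks) ⟩
      [ suc (suc k) ] * (q ^ a * ([ suc b ] * E ks)) ∎)
      (block a (suc (b ℕ.+ suc k)) ks (≡.trans (≡.sym (ℕ.+-assoc (a ℕ.+ a) (suc b) (suc k))) (≡.cong (ℕ._+ suc k) eq))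
        ⊞ recentre (≡.sym (ℕ.+-suc d k))
            ([]*-block k (suc a) b ks (≡.trans
              (S.solve 2 (λ a b → S.con 1 S.:+ a S.:+ (S.con 1 S.:+ a) S.:+ b S.:= S.con 1 S.:+ (a S.:+ a S.:+ (S.con 1 S.:+ b))) ≡.refl a b)
              (≡.cong suc eq))))
      where module S = +-*-Solver

    []*-blocks : ∀ {d f} k → Blocks d f → Blocks (d ℕ.+ k) ([ suc k ] * f)
    []*-blocks k = *-blocks [ suc k ] ([]*-block k)

    -- The factor `[ suc i ]` raises twice the centre by i, and these shifts add up to `triangle k`.
    []!*-blocks : ∀ {d f} k → Blocks d f → Blocks (d ℕ.+ triangle k) ([]! k * f)
    []!*-blocks {d} zero p = resp (sym (*-identityˡ _)) (recentre (≡.sym (ℕ.+-identityʳ d)) p)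
    []!*-blocks {d} (suc k) p = resp (sym (*-assoc _ _ _)) (recentre (ℕ.+-assoc d k (triangle k))
      ([]!*-blocks k ([]*-blocks k p)))

    qint-e-blocks : ∀ a b i j {d} → a ℕ.+ a ℕ.+ b ≡ suc d → Blocks d (q ^ a * [ b ] * (e x i * e x j))
    qint-e-blocks a b i j eq = resp (begin
      q ^ a * ([ b ] * E (i ∷ j ∷ []))
        ≈⟨ *-congˡ (*-congˡ (trans (E-∷ i _) (*-congˡ (trans (E-∷ j []) (*-congˡ E-[]))))) ⟩
      q ^ a * ([ b ] * (e x i * (e x j * 1#)))
        ≈⟨ solve 4 (λ p s u v → p :* (s :* (u :* (v :* con 1))) := p :* s :* (u :* v)) refl (q ^ a) [ b ] (e x i) (e x j) ⟩
      q ^ a * [ b ] * (e x i * e x j) ∎) (block a b (i ∷ j ∷ []) eq)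

    B₀-blocks≤ : ∀ a b → a ℕ.≤ b → Blocks (a ℕ.+ b) (B x a 0 b)
    B₀-blocks≤ zero b _ = resp (trans (solve 2 (λ s u → con 1 :* s :* (u :* con 1) := s :* u) refl [ suc b ] (e x (suc b))) (sym (B-0-0 x b)))
      (qint-e-blocks 0 (suc b) (suc b) 0 ≡.refl)
    B₀-blocks≤ (suc a) b a<b with b ℕ.∸ a | ℕ.m+[n∸m]≡n (ℕ.<⇒≤ a<b)
    ... | j | ≡.refl = resp (sym (B-descent x a j))
      (recentre (ℕ.+-suc a (a ℕ.+ j)) (B₀-blocks≤ a (suc (a ℕ.+ j)) (ℕ.m≤n⇒m≤1+n (ℕ.m≤m+n a j)))
        -- Here `j` is the length of the interval and the third summand of the centre condition; the
        -- condition `2 (a + 1) + j = d + 1` is the one checked.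
        ⊞ qint-e-blocks (suc a) j (suc (a ℕ.+ j)) (suc a) (≡.cong suc (≡.trans (≡.cong (ℕ._+ j) (ℕ.+-suc a a)) (≡.cong suc (ℕ.+-assoc a a j)))))

    -- The recursion in `B-blocks` restarts the right clique at one vertex, so it reaches pairs with
    -- `a > b`, to which the descent does not apply directly; symmetry covers them.
    B₀-blocks : ∀ a b → Blocks (a ℕ.+ b) (B x a 0 b)
    B₀-blocks a b with ℕ.≤-total a b
    ... | inj₁ a≤b = B₀-blocks≤ a b a≤b
    ... | inj₂ b≤a = recentre (ℕ.+-comm b a) (resp (B-sym x b 0 a) (B₀-blocks≤ b a b≤a))

    B-blocks : ∀ a n k → Blocks (a ℕ.+ (n ℕ.+ k)) (B x a n k)
    B-blocks a zero k = B₀-blocks a k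
    B-blocks a (suc n) k = resp (sym (B-stepʳ x a n k)) (shorter k ⊞ recentre (≡.cong (a ℕ.+_) (ℕ.+-suc n k)) (B-blocks a n (suc k)))
      where
      shorter : ∀ k → Blocks (a ℕ.+ (suc n ℕ.+ k)) (q * [ k ] * e x (suc k) * B x a n 0)
      shorter zero = resp (solve 3 (λ z u v → con 0 := z :* con 0 :* u :* v) refl q (e x 1) (B x a n 0)) none
      -- The factor `q` raises twice the centre by 2, `[ suc k ]` by `k`, and the elementary
      -- symmetric factor not at all. This makes up exactly for the shorter chain.
      shorter (suc k) = resp (solve 4 (λ z s u v → z :* (s :* (u :* v)) := z :* s :* u :* v) refl q [ suc k ] (e x (suc (suc k))) (B x a n 0))
        (recentre
          (S.solve 3 (λ a n k → S.con 2 S.:+ (a S.:+ (n S.:+ S.con 0) S.:+ k) S.:= a S.:+ (S.con 1 S.:+ n S.:+ (S.con 1 S.:+ k))) ≡.refl a n k)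
          (q*-blocks ([]*-blocks k (e*-blocks (suc (suc k)) (B-blocks a n 0)))))
        where module S = +-*-Solver

open import Data.Nat using (_≤_; _<_; _∸_; _+_; _*_)

-- Edges of K_r + L_{m,n} and of lollipops

<ᵇ-true : ∀ {m n} → m ℕ.< n → (m <ᵇ n) ≡ true
<ᵇ-true m<n = Equivalence.to T-≡ (ℕ.<⇒<ᵇ m<n)

-- Deleting the first vertex lowers the two endpoints together with the remaining clique or path
-- bound, and Boolean comparisons of successors compute, so the recursive calls fit without
-- arithmetic. Only the final clique needs the bound on `j`.
KrL-chain : ∀ a n k {i j} → i ℕ.< j → j ℕ.< suc (a + (n + k)) → edge₀ (KrL (suc a) (suc k) n) i j ≡ chain a n i j
KrL-chain zero zero k {i} {suc j} i<j j<d = ≡.cong₂ _∨_ (∧-zeroʳ (j ≡ᵇ i)) (<ᵇ-true j<d)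
KrL-chain zero (suc n) k {zero} {suc zero} i<j j<d = ≡.refl
KrL-chain zero (suc n) k {zero} {suc (suc j)} i<j j<d = ≡.refl
KrL-chain zero (suc n) k {suc i} {suc zero} (ℕ.s≤s ()) j<d
KrL-chain zero (suc n) k {suc i} {suc (suc j)} i<j j<d = KrL-chain zero n k (ℕ.s<s⁻¹ i<j) (ℕ.s<s⁻¹ j<d)
KrL-chain (suc a) n k {zero} {suc j} i<j j<d = ∨-identityʳ (j <ᵇ suc a)
KrL-chain (suc a) n k {suc i} {suc j} i<j j<d = KrL-chain a n k (ℕ.s<s⁻¹ i<j) (ℕ.s<s⁻¹ j<d)

Lollipop-chain : ∀ n k {i j} → i ℕ.< j → j ℕ.< suc (n + k) → edge₀ (Lollipop (suc k) n) i j ≡ chain 0 n i j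
Lollipop-chain zero k {i} {suc j} i<j j<d = ≡.cong₂ _∨_ (∧-zeroʳ (j ≡ᵇ i)) (<ᵇ-true j<d)
Lollipop-chain (suc n) k {zero} {suc zero} i<j j<d = ≡.refl
Lollipop-chain (suc n) k {zero} {suc (suc j)} i<j j<d = ≡.refl
Lollipop-chain (suc n) k {suc i} {suc j} i<j j<d = Lollipop-chain n k (ℕ.s<s⁻¹ i<j) (ℕ.s<s⁻¹ j<d)

KrL-size : ∀ a n k → size (KrL (suc a) (suc k) n) ≡ suc (a + (n + k))
KrL-size a n k = ≡.trans (≡.cong (ℕ._∸ 1) (ℕ.+-suc (n + suc k) a))
  (solve 3 (λ n k a → n :+ (con 1 :+ k) :+ a := con 1 :+ (a :+ (n :+ k))) ≡.refl n k a)
  where open +-*-Solver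

Lollipop-size : ∀ n k → size (Lollipop (suc k) n) ≡ suc (n + k)
Lollipop-size n k = ≡.cong suc (ℕ.+-comm k n)

-- Counting edges

open ListFold ℕ.+-0-monoid
open import Algebra.Properties.Monoid.Sum ℕ.+-0-monoid using (sum; sum-cong-≗)

𝟙 : Bool → ℕ
𝟙 b = if b then 1 else 0

edgeCount : ℕ → (ℕ → ℕ → Bool) → ℕ
edgeCount zero E = 0
edgeCount (suc d) E = sum {d} (λ j → 𝟙 (E 0 (suc (toℕ j)))) + edgeCount d (λ i j → E (suc i) (suc j))

countᵇ-fold : ∀ {A : Set} (p : A → Bool) xs → countᵇ p xs ≡ fold (𝟙 ∘ p) xs
countᵇ-fold p [] = ≡.refl
countᵇ-fold p (x ∷ xs) with p x
... | true = ≡.cong suc (countᵇ-fold p xs)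
... | false = countᵇ-fold p xs

sum-edges : ∀ d (E : ℕ → ℕ → Bool) →
  sum {d} (λ i → sum {d} (λ j → 𝟙 ((toℕ i <ᵇ toℕ j) ∧ E (toℕ i) (toℕ j)))) ≡ edgeCount d E
sum-edges zero E = ≡.refl
sum-edges (suc d) E = ≡.cong (λ s → sum {d} (λ j → 𝟙 (E 0 (suc (toℕ j)))) + s) (sum-edges d (λ i j → E (suc i) (suc j)))

numEdges-edgeCount : ∀ G → numEdges G ≡ edgeCount (size G) (edge₀ G)
numEdges-edgeCount G = ≡.trans (countᵇ-fold (isEdgeᵇ G) (pairsOf (size G)))
  (≡.trans (fold-pairsOf (𝟙 ∘ isEdgeᵇ G)) (sum-edges (size G) (edge₀ G)))

edgeCount-cong : ∀ d {E E′} → (∀ {i j} → i ℕ.< j → j ℕ.< d → E i j ≡ E′ i j) → edgeCount d E ≡ edgeCount d E′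
edgeCount-cong zero h = ≡.refl
edgeCount-cong (suc d) h = ≡.cong₂ _+_
  (sum-cong-≗ (λ j → ≡.cong 𝟙 (h ℕ.z<s (ℕ.s<s (toℕ<n j)))))
  (edgeCount-cong d (λ i<j j<d → h (ℕ.s<s i<j) (ℕ.s<s j<d)))

sum-below : ∀ a m → sum {a + m} (λ j → 𝟙 (toℕ j <ᵇ a)) ≡ a
sum-below zero zero = ≡.refl
sum-below zero (suc m) = sum-below zero m
sum-below (suc a) m = ≡.cong suc (sum-below a m)

edgeCount-clique : ∀ d → edgeCount d (λ i j → true) ≡ triangle d
edgeCount-clique zero = ≡.refl
edgeCount-clique (suc d) = ≡.cong₂ _+_ (sum-ones d) (edgeCount-clique d)
  where
  sum-ones : ∀ d → sum {d} (λ j → 1) ≡ d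
  sum-ones zero = ≡.refl
  sum-ones (suc d) = ≡.cong suc (sum-ones d)

edgeCount-chain : ∀ a n k → edgeCount (suc (a + (n + k))) (chain a n) ≡ triangle (suc a) + (n + triangle (suc k))
edgeCount-chain zero zero k = edgeCount-clique (suc k)
edgeCount-chain zero (suc n) k = ≡.cong₂ _+_ (sum-below 1 (n + k)) (edgeCount-chain zero n k)
edgeCount-chain (suc a) n k = ≡.trans (≡.cong₂ _+_ (sum-below (suc a) (n + k)) (edgeCount-chain a n k))
  (≡.sym (ℕ.+-assoc (suc a) (triangle (suc a)) _))

numEdges-KrL : ∀ a n k → numEdges (KrL (suc a) (suc k) n) ≡ triangle (suc a) + (n + triangle (suc k))
numEdges-KrL a n k = begin
  numEdges (KrL (suc a) (suc k) n)                                   ≡⟨ numEdges-edgeCount (KrL (suc a) (suc k) n) ⟩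
  edgeCount (size (KrL (suc a) (suc k) n)) (edge₀ (KrL (suc a) (suc k) n))
    ≡⟨ ≡.cong (λ d → edgeCount d (edge₀ (KrL (suc a) (suc k) n))) (KrL-size a n k) ⟩
  edgeCount (suc (a + (n + k))) (edge₀ (KrL (suc a) (suc k) n))      ≡⟨ edgeCount-cong _ (KrL-chain a n k) ⟩
  edgeCount (suc (a + (n + k))) (chain a n)                          ≡⟨ edgeCount-chain a n k ⟩
  triangle (suc a) + (n + triangle (suc k))                          ∎
  where open ≡.≡-Reasoning

-- Positivity and unimodality

sumℤ-zero : ∀ {A : Set} (f : A → ℤ) → (∀ a → f a ≡ + 0) → ∀ xs → sumℤ (map f xs) ≡ + 0
sumℤ-zero f h [] = ≡.refl
sumℤ-zero f h (x ∷ xs) = ≡.cong₂ ℤ._+_ (h x) (sumℤ-zero f h xs)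

-- `EPosSym` looks at `eProd` in q-degree 0 only. Knowing that the other q-coefficients vanish makes
-- every coefficient of `[ b ] ⊗ eProd ks` either that value or zero.
q-Free : ∀ {N} → Poly N → Set
q-Free f = ∀ α t → f α (suc t) ≡ + 0

⊗-q-free : ∀ {N} (f g : Poly N) → q-Free f → q-Free g → q-Free (f ⊗ g)
⊗-q-free f g hf hg α t = sumℤ-zero _ (λ { (β , γ) → sumℤ-zero _ (term β γ) (upTo (suc (suc t))) }) (splits α)
  where
  term : ∀ β γ s → f β s ℤ.* g γ (suc t ∸ s) ≡ + 0
  term β γ zero = ≡.trans (≡.cong (f β 0 ℤ.*_) (hg γ t)) (ℤ.*-zeroʳ (f β 0))
  term β γ (suc s) = ≡.trans (≡.cong (ℤ._* g γ (t ∸ s)) (hf β s)) (ℤ.*-zeroˡ (g γ (t ∸ s)))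

eProd-q-free : ∀ {N} ks → q-Free (eProd {N} ks)
eProd-q-free [] α t = ≡.cong (λ b → if b then + 1 else + 0) (∧-zeroʳ (isZeroᵇ α))
eProd-q-free (k ∷ ks) = ⊗-q-free (elem k) (eProd ks) elem-q-free (eProd-q-free ks)
  where
  elem-q-free : q-Free (elem k)
  elem-q-free α t = ≡.cong (λ b → if b then + 1 else + 0)
    (≡.trans (≡.cong (all≤1ᵇ α ∧_) (∧-zeroʳ (degree α ≡ᵇ k))) (∧-zeroʳ (all≤1ᵇ α)))

EPos-≡ : ∀ {N} {s s′ : SymN N} → (∀ α → s α ≡ s′ α) → EPosSym s → EPosSym s′
EPos-≡ h (L , p) = L , λ α → ≡.trans (≡.sym (h α)) (p α)

EPos-zero : ∀ {N} {s : SymN N} → (∀ α → s α ≡ + 0) → EPosSym s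
EPos-zero h = [] , h

EPos-eProd : ∀ {N} {s : SymN N} ks → (∀ α → s α ≡ eProd ks α 0) → EPosSym s
EPos-eProd ks h = ks ∷ [] , λ α → ≡.trans (h α) (≡.sym (ℤ.+-identityʳ _))

EPos-+ : ∀ {N} {s s′ : SymN N} → EPosSym s → EPosSym s′ → EPosSym (λ α → s α ℤ.+ s′ α)
EPos-+ (L , p) (L′ , p′) = L List.++ L′ , λ α → ≡.trans (≡.cong₂ ℤ._+_ (p α) (p′ α))
  (≡.trans (≡.sym (sumℤ-++ (map _ L) (map _ L′))) (≡.cong sumℤ (≡.sym (List.map-++ _ L L′))))

data Position (a b t : ℕ) : Set where
  below : t < a → Position a b t
  inside : a ≤ t → t < a + b → Position a b t
  above : a + b ≤ t → Position a b t

position : ∀ a b t → Position a b t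
position a b t with t ℕ.<? a
... | yes t<a = below t<a
... | no t≮a with t ℕ.<? a + b
... | yes t<a+b = inside (ℕ.≮⇒≥ t≮a) t<a+b
... | no t≮a+b = above (ℕ.≮⇒≥ t≮a+b)

module _ {N : ℕ} where
  open CommutativeRing (polyRing N) using (setoid; semiring; refl; sym; trans; *-assoc; *-identityˡ; zeroˡ; distribʳ; +-cong; *-cong; *-congˡ; *-congʳ)
  open import Algebra.Properties.Semiring.Exp semiring using (_^_)
  open Poly-q N hiding (above; below)
  open BlockSums (polyRing N) (qpow 1)
  open import Relation.Binary.Reasoning.Setoid setoid

  ⊗-cong : ∀ {f f′ g g′ : Poly N} → f ≐ f′ → g ≐ g′ → f ⊗ g ≐ f′ ⊗ g′
  ⊗-cong {f} {f′} {g} {g′} = *-cong {x = f} {y = f′} {u = g} {v = g′}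

  ⊕-cong : ∀ {f f′ g g′ : Poly N} → f ≐ f′ → g ≐ g′ → f ⊕ g ≐ f′ ⊕ g′
  ⊕-cong f≐f′ g≐g′ α t = ≡.cong₂ ℤ._+_ (f≐f′ α t) (g≐g′ α t)

  [suc]⊗ : ∀ b (g : Poly N) → [ suc b ] ⊗ g ≐ g ⊕ qpow 1 ⊗ ([ b ] ⊗ g)
  [suc]⊗ b g = trans {i = [ suc b ] ⊗ g} (distribʳ g (qpow 0) (qpow 1 ⊗ [ b ]))
    (+-cong {x = qpow 0 ⊗ g} {u = qpow 1 ⊗ [ b ] ⊗ g} (*-identityˡ g) (*-assoc (qpow 1) [ b ] g))

  []⊗-inside : ∀ b (g : Poly N) → q-Free g → ∀ α t → t < b → ([ b ] ⊗ g) α t ≡ g α 0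
  []⊗-inside (suc b) g free α zero _ = ≡.trans ([suc]⊗ b g α 0)
    (≡.trans (≡.cong (λ z → g α 0 ℤ.+ z) (q⊗-zero ([ b ] ⊗ g) α)) (ℤ.+-identityʳ _))
  []⊗-inside (suc b) g free α (suc t) (s≤s t<b) = ≡.trans ([suc]⊗ b g α (suc t))
    (≡.trans (≡.cong₂ ℤ._+_ (free α t) (≡.trans (q⊗-suc ([ b ] ⊗ g) α t) ([]⊗-inside b g free α t t<b))) (ℤ.+-identityˡ _))

  []⊗-above : ∀ b (g : Poly N) → q-Free g → ∀ α t → b ≤ t → ([ b ] ⊗ g) α t ≡ + 0
  []⊗-above zero g free α t _ = zeroˡ g α t
  []⊗-above (suc b) g free α (suc t) (s≤s b≤t) = ≡.trans ([suc]⊗ b g α (suc t))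
    (≡.cong₂ ℤ._+_ (free α t) (≡.trans (q⊗-suc ([ b ] ⊗ g) α t) ([]⊗-above b g free α t b≤t)))

  q^⊗-below : ∀ a (f : Poly N) α t → t < a → (qpow 1 ^ a ⊗ f) α t ≡ + 0
  q^⊗-below (suc a) f α zero _ = ≡.trans (*-assoc (qpow 1) (qpow 1 ^ a) f α 0) (q⊗-zero (qpow 1 ^ a ⊗ f) α)
  q^⊗-below (suc a) f α (suc t) (s≤s t<a) = ≡.trans (*-assoc (qpow 1) (qpow 1 ^ a) f α (suc t))
    (≡.trans (q⊗-suc (qpow 1 ^ a ⊗ f) α t) (q^⊗-below a f α t t<a))

  q^⊗-shift : ∀ a (f : Poly N) α t → (qpow 1 ^ a ⊗ f) α (a + t) ≡ f α t
  q^⊗-shift zero f α t = *-identityˡ f α t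
  q^⊗-shift (suc a) f α t = ≡.trans (*-assoc (qpow 1) (qpow 1 ^ a) f α (suc (a + t)))
    (≡.trans (q⊗-suc (qpow 1 ^ a ⊗ f) α (a + t)) (q^⊗-shift a f α t))

  module _ (a b : ℕ) (ks : List ℕ) where
    private
      f : Poly N
      f = qpow 1 ^ a ⊗ ([ b ] ⊗ eProd ks)

    block-below : ∀ α t → t < a → f α t ≡ + 0
    block-below = q^⊗-below a ([ b ] ⊗ eProd ks)

    block-inside : ∀ α t → a ≤ t → t < a + b → f α t ≡ eProd ks α 0
    block-inside α t a≤t t<a+b with t ∸ a | ℕ.m+[n∸m]≡n a≤t
    ... | s | ≡.refl = ≡.trans (q^⊗-shift a ([ b ] ⊗ eProd ks) α s)
      ([]⊗-inside b (eProd ks) (eProd-q-free ks) α s (ℕ.+-cancelˡ-< a s b t<a+b))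

    block-above : ∀ α t → a + b ≤ t → f α t ≡ + 0
    block-above α t a+b≤t with t ∸ a | ℕ.m+[n∸m]≡n (ℕ.m+n≤o⇒m≤o a a+b≤t)
    ... | s | ≡.refl = ≡.trans (q^⊗-shift a ([ b ] ⊗ eProd ks) α s)
      ([]⊗-above b (eProd ks) (eProd-q-free ks) α s (ℕ.+-cancelˡ-≤ a b s a+b≤t))

    block-ePositive : EPositive f
    block-ePositive t with position a b t
    ... | below t<a = EPos-zero (λ α → block-below α t t<a)
    ... | inside a≤t t<a+b = EPos-eProd ks (λ α → block-inside α t a≤t t<a+b)
    ... | above a+b≤t = EPos-zero (λ α → block-above α t a+b≤t)

    module _ {d : ℕ} (centre : a + a + b ≡ suc d) where
      a+a+b≡ : a + a + b ≡ a + (a + b)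
      a+a+b≡ = ℕ.+-assoc a a b

      -- Put `u = d ∸ t`. From `a + (a + b) = t + u + 1`, the reflection exchanges the positions
      -- below and above the interval and preserves its inside.
      block-symmetric : ∀ t α → t ≤ d → f α t ≡ f α (d ∸ t)
      block-symmetric t α t≤d with d ∸ t | ℕ.m+[n∸m]≡n t≤d
      ... | u | ≡.refl with position a b t
      ... | below t<a = ≡.trans (block-below α t t<a) (≡.sym (block-above α u
              (ℕ.+-cancelˡ-≤ t (a + b) u (ℕ.s≤s⁻¹ (ℕ.≤-trans (ℕ.+-monoˡ-≤ (a + b) t<a) (ℕ.≤-reflexive (≡.trans (≡.sym a+a+b≡) centre)))))))
      ... | inside a≤t t<a+b = ≡.trans (block-inside α t a≤t t<a+b) (≡.sym (block-inside α u
              (ℕ.+-cancelˡ-≤ t a u (ℕ.s≤s⁻¹ (ℕ.≤-trans (ℕ.+-monoˡ-≤ a t<a+b) (ℕ.≤-reflexive (≡.trans (≡.trans (ℕ.+-comm (a + b) a) (≡.sym a+a+b≡)) centre)))))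
              (ℕ.+-cancelˡ-≤ a (suc u) (a + b) (ℕ.≤-trans (ℕ.+-monoˡ-≤ (suc u) a≤t)
                (ℕ.≤-reflexive (≡.trans (ℕ.+-suc t u) (≡.trans (≡.sym centre) a+a+b≡)))))))
      ... | above a+b≤t = ≡.trans (block-above α t a+b≤t) (≡.sym (block-below α u
              (ℕ.+-cancelˡ-≤ (a + b) (suc u) a (ℕ.≤-trans (ℕ.+-monoˡ-≤ (suc u) a+b≤t)
                (ℕ.≤-reflexive (≡.trans (ℕ.+-suc t u) (≡.trans (≡.sym centre) (≡.trans a+a+b≡ (ℕ.+-comm a (a + b))))))))))

      block-bounded : ∀ t α → d < t → f α t ≡ + 0
      block-bounded t α d<t = block-above α t (ℕ.≤-trans (ℕ.m≤n+m (a + b) a)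
        (ℕ.≤-trans (ℕ.≤-reflexive (≡.trans (≡.sym a+a+b≡) centre)) d<t))

      -- The coefficient can drop only on leaving the interval, that is when `a + b ≤ t + 1`. Then
      -- `d + 1 = a + (a + b) ≤ 2 t + 2`, so t is no longer in the first half. Entering the interval
      -- adds one `eProd ks`; every other step changes nothing.
      block-increasing : ∀ t → suc (2 * t) < d → EPosSym (λ α → f α (suc t) ℤ.- f α t)
      block-increasing t 2t+1<d with position a b (suc t)
      ... | below t+1<a = EPos-zero (λ α → ≡.cong₂ ℤ._-_ (block-below α (suc t) t+1<a) (block-below α t (ℕ.<-trans (ℕ.n<1+n t) t+1<a)))
      ... | above a+b≤t+1 = contradiction 2t+1<d (ℕ.≤⇒≯ (ℕ.s≤s⁻¹ (ℕ.≤-trans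
              (ℕ.≤-reflexive (≡.trans (≡.sym centre) a+a+b≡))
              (ℕ.≤-trans (ℕ.+-mono-≤ (ℕ.≤-trans (ℕ.m≤m+n a b) a+b≤t+1) a+b≤t+1) (ℕ.≤-reflexive (double t))))))
        where
        double : ∀ t → suc t + suc t ≡ suc (suc (2 * t))
        double t = solveℕ 1 (λ t → con 1 :+ t :+ (con 1 :+ t) := con 2 :+ con 2 :* t) ≡.refl t
          where open +-*-Solver renaming (solve to solveℕ)
      ... | inside a≤t+1 t+1<a+b with t ℕ.<? a
      ... | yes t<a = EPos-eProd ks (λ α → ≡.trans (≡.cong₂ ℤ._-_ (block-inside α (suc t) a≤t+1 t+1<a+b) (block-below α t t<a)) (ℤ.+-identityʳ _))
      ... | no t≮a = EPos-zero (λ α → ≡.trans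
              (≡.cong₂ ℤ._-_ (block-inside α (suc t) a≤t+1 t+1<a+b) (block-inside α t (ℕ.≮⇒≥ t≮a) (ℕ.<-trans (ℕ.n<1+n t) t+1<a+b)))
              (ℤ.+-inverseʳ (eProd ks α 0)))

  eProd-[] : eProd {N} [] ≐ qpow 0
  eProd-[] α t = ≡.refl

  eProd-∷ : ∀ k ks → eProd (k ∷ ks) ≐ e var k ⊗ eProd ks
  eProd-∷ k ks = *-congʳ {x = eProd ks} {x = elem k} (elem-e k)

  open Blocks-of {N} var eProd eProd-[] eProd-∷

  blocks-ePositive : ∀ {d f} → Blocks d f → EPositive f
  blocks-ePositive (block a b ks _) = block-ePositive a b ks
  blocks-ePositive none t = EPos-zero (λ α → ≡.refl)
  blocks-ePositive (p ⊞ r) t = EPos-+ (blocks-ePositive p t) (blocks-ePositive r t)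
  blocks-ePositive (resp f≈g p) t = EPos-≡ (λ α → f≈g α t) (blocks-ePositive p t)

  blocks-symmetric : ∀ {d f} → Blocks d f → ∀ t α → t ≤ d → f α t ≡ f α (d ∸ t)
  blocks-symmetric (block a b ks centre) = block-symmetric a b ks centre
  blocks-symmetric none t α _ = ≡.refl
  blocks-symmetric (p ⊞ r) t α t≤d = ≡.cong₂ ℤ._+_ (blocks-symmetric p t α t≤d) (blocks-symmetric r t α t≤d)
  blocks-symmetric {d} (resp f≈g p) t α t≤d =
    ≡.trans (≡.sym (f≈g α t)) (≡.trans (blocks-symmetric p t α t≤d) (f≈g α (d ∸ t)))

  blocks-bounded : ∀ {d f} → Blocks d f → ∀ t α → d < t → f α t ≡ + 0
  blocks-bounded (block a b ks centre) = block-bounded a b ks centre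
  blocks-bounded none t α _ = ≡.refl
  blocks-bounded (p ⊞ r) t α d<t = ≡.cong₂ ℤ._+_ (blocks-bounded p t α d<t) (blocks-bounded r t α d<t)
  blocks-bounded (resp f≈g p) t α d<t = ≡.trans (≡.sym (f≈g α t)) (blocks-bounded p t α d<t)

  blocks-increasing : ∀ {d f} → Blocks d f → ∀ t → suc (2 * t) < d → EPosSym (λ α → f α (suc t) ℤ.- f α t)
  blocks-increasing (block a b ks centre) = block-increasing a b ks centre
  blocks-increasing none t _ = EPos-zero (λ α → ≡.refl)
  blocks-increasing (_⊞_ {f} {g} p r) t t< = EPos-≡
    (λ α → solveℤ 4 (λ u v x y → (u :- v) :+ (x :- y) := (u :+ x) :- (v :+ y)) ≡.refl (f α (suc t)) (f α t) (g α (suc t)) (g α t))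
    (EPos-+ (blocks-increasing p t t<) (blocks-increasing r t t<))
    where open ℤSolver.+-*-Solver renaming (solve to solveℤ)
  blocks-increasing (resp f≈g p) t t< = EPos-≡ (λ α → ≡.cong₂ ℤ._-_ (f≈g α (suc t)) (f≈g α t)) (blocks-increasing p t t<)

  blocks-eUnimodal : ∀ {d f} → Blocks d f → EUnimodal f d
  blocks-eUnimodal p = blocks-symmetric p , blocks-bounded p , blocks-increasing p

  -- Chromatic functions of chains and lollipops, and the theorem

  X-chain : ∀ G a n k → size G ≡ suc (a + (n + k)) →
    (∀ {i j} → i < j → j < suc (a + (n + k)) → edge₀ G i j ≡ chain a n i j) →
    X G ≐ []! k ⊗ ([]! a ⊗ B var a n k)
  X-chain G a n k size≡ edge≡ = begin
    X G                                                       ≈⟨ X-coloringSum G ⟩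
    coloringSum (size G) (edge₀ G) (λ _ → var)                ≡⟨ ≡.cong (λ d → coloringSum d (edge₀ G) (λ _ → var)) size≡ ⟩
    coloringSum (suc (a + (n + k))) (edge₀ G) (λ _ → var)     ≈⟨ coloringSum-cong {N} (suc (a + (n + k))) {E = edge₀ G} {Y = λ _ → var} {Y′ = λ _ → var} edge≡ (λ _ _ → refl) ⟩
    coloringSum (suc (a + (n + k))) (chain a n) (λ _ → var)   ≈⟨ coloringSum-chain var a n k ⟩
    []! k ⊗ ([]! a ⊗ B var a n k)                             ∎

  X-KrL : ∀ a n k → X (KrL (suc a) (suc k) n) ≐ []! k ⊗ ([]! a ⊗ B var a n k)
  X-KrL a n k = X-chain (KrL (suc a) (suc k) n) a n k (KrL-size a n k) (KrL-chain a n k)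

  -- The lollipop is a chain whose left clique is a single vertex, which gives `B var 0 j a`; the
  -- symmetry of `B` turns this into the terms `B var a j 0` that occur in the expansion.
  X-Lollipop : ∀ a j → X (Lollipop (suc a) j) ≐ []! a ⊗ B var a j 0
  X-Lollipop a j = begin
    X (Lollipop (suc a) j)             ≈⟨ X-chain (Lollipop (suc a) j) 0 j a (Lollipop-size j a) (Lollipop-chain j a) ⟩
    []! a ⊗ (qpow 0 ⊗ B var 0 j a)     ≈⟨ *-congˡ {x = []! a} (trans (*-identityˡ (B var 0 j a)) (B-sym var 0 j a)) ⟩
    []! a ⊗ B var a j 0                ∎

  KrL-blocks : ∀ a n k → Blocks (numEdges (KrL (suc a) (suc k) n)) (X (KrL (suc a) (suc k) n))
  KrL-blocks a n k = recentre
    -- Twice the centre is `a + n + k` from `B` plus the degrees of the two q-factorials; regrouped,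
    -- this counts the edges of the two cliques and the path.
    (≡.trans (solveℕ 5 (λ a n k s t → a :+ (n :+ k) :+ s :+ t := a :+ s :+ (n :+ (k :+ t))) ≡.refl a n k (triangle a) (triangle k))
      (≡.sym (numEdges-KrL a n k)))
    (resp (sym (X-KrL a n k)) ([]!*-blocks k ([]!*-blocks a (B-blocks a n k))))
    where open +-*-Solver renaming (solve to solveℕ)

  KrL-formula : ∀ a n k → a ≤ k →
    X (KrL (suc a) (suc k) n) ≐
      qfact k ⊗
        (ΣP (suc a) (λ i → qpow i ⊗ qfact a ⊗ qint ((n + suc k + suc a ∸ 1) ∸ 2 * i) ⊗ e₂ ((n + suc k + suc a ∸ 1) ∸ i) i)
         ⊕ ΣP n (λ j → qpow 1 ⊗ qint (n + suc k ∸ j ∸ 2) ⊗ X (Lollipop (suc a) j) ⊗ elem (n + suc k ∸ j ∸ 1)))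
  KrL-formula a n k a≤k = begin
    X (KrL (suc a) (suc k) n)
      ≈⟨ X-KrL a n k ⟩
    []! k ⊗ ([]! a ⊗ B var a n k)
      -- The closed form inside needs `a ≤ n + k`; this is where r ≤ m, in the form `a ≤ k`, enters.
      ≈⟨ *-congˡ {x = []! k} (B-formula var a n k (ℕ.≤-trans a≤k (ℕ.m≤n+m k n)) (≡.sym (KrL-size a n k))) ⟩
    []! k ⊗ (∑< (suc a) (λ i → qpow 1 ^ i ⊗ []! a ⊗ [ d ∸ 2 * i ] ⊗ (e var (d ∸ i) ⊗ e var i))
      ⊕ ∑< n (λ j → qpow 1 ⊗ [ n + suc k ∸ j ∸ 2 ] ⊗ ([]! a ⊗ B var a j 0) ⊗ e var (n + suc k ∸ j ∸ 1)))
      ≈⟨ ⊗-cong (sym (qfact-[]! k)) (⊕-cong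
           (trans (∑<-cong (suc a) (λ i _ → ⊗-cong (⊗-cong (⊗-cong (sym (qpow-^ i)) (sym (qfact-[]! a))) (sym (qint-[] (d ∸ 2 * i))))
                     (⊗-cong (sym (elem-e (d ∸ i))) (sym (elem-e i)))))
                  (sym (ΣP-∑< (suc a) _)))
           (trans (∑<-cong n (λ j _ → ⊗-cong (⊗-cong (⊗-cong (refl {x = qpow 1}) (sym (qint-[] (n + suc k ∸ j ∸ 2)))) (sym (X-Lollipop a j)))
                     (sym (elem-e (n + suc k ∸ j ∸ 1)))))
                  (sym (ΣP-∑< n _)))) ⟩
    _ ∎
    where
    d = n + suc k + suc a ∸ 1

theorem4p6 : (m r n : ℕ) → 3 ≤ m → 1 ≤ r → r ≤ m →
    ((N : ℕ) (α : Mono N) (t : ℕ) →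
    X (KrL r m n) α t ≡
    (qfact (m ∸ 1) ⊗
    (ΣP r (λ i → qpow i ⊗ qfact (r ∸ 1) ⊗ qint ((n + m + r ∸ 1) ∸ 2 * i)
    ⊗ e₂ ((n + m + r ∸ 1) ∸ i) i)
    ⊕ ΣP n (λ j → qpow 1 ⊗ qint (n + m ∸ j ∸ 2) ⊗ X (Lollipop r j)
    ⊗ elem (n + m ∸ j ∸ 1)))) α t)
    × ((N : ℕ) → EPositive {N} (X (KrL r m n)))
    × ((N : ℕ) → EUnimodal {N} (X (KrL r m n)) (numEdges (KrL r m n)))
theorem4p6 (suc k) (suc a) n _ _ (s≤s a≤k) =
  (λ N → KrL-formula a n k a≤k) , (λ N → blocks-ePositive (KrL-blocks a n k)) , (λ N → blocks-eUnimodal (KrL-blocks a n k))
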